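{- Let $P$ be a noncrossing partition of $\{1,\dots,n\}$ and $\gamma=(A,B,C,D)$ a four-coloring given by integers $1\le i<j\le k<\ell\le n$. Then $\Phi(P,\gamma)$ is a permutation of genus $0$ or $1$. It has genus $1$ if and only if at least one of the following holds: (1) some part of $P$ meets at least three of the sets $A,B,C,D$; (2) there are two parts $P_q,P_r$ of $P$ and three distinct colors $X,Y,Z\in\{A,B,C,D\}$ such that $P_q\cap X\ne\emptyset$, $P_q\cap Y\neq\emptyset$, $P_q\subseteq X\cup Y$, and $P_r\cap X\ne\emptyset$, $P_r\cap Z\ne\emptyset$, $P_r\subseteq X\cup Z$.
   Context: Permutations are composed right to left; $\zeta_n=(1,2,\dots,n)$; $z(\pi)$ is the number of cycles of $\pi$; the genus $g(\alpha)$ of $\alpha\in S_n$ is defined by $n+1-2g(\alpha)=z(\alpha)+z(\alpha^{ -1}\zeta_n)$. A partition $P$ of $\{1,\dots,n\}$ is identified with the permutation $\beta_P$ whose cycles are the blocks of $P$ written in increasing order; it is noncrossing if there are no $a<b<a'<b'$ with $a,a'$ in one block and $b,b'$ in a different block. A four-coloring $\gamma=(A,B,C,D)$ of $\{1,\dots,n\}$ is given by integers $1\le i<j\le k<\ell\le n$: $A=\{\ell+1,\dots,n\}\cup\{1,\dots,i\}$, $B=\{i+1,\dots,j\}$, $C=\{j+1,\dots,k\}$ (empty if $j=k$), $D=\{k+1,\dots,\ell\}$. Define $\phi\in S_n$ by $\phi(x)=x$ for $x\in A$, $\phi(x)=x+\ell-j$ for $x\in B$, $\phi(x)=x+i+\ell-j-k$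 for $x\in C$, $\phi(x)=x+i-k$ for $x\in D$ (this relabels so that $A$ keeps its labels and then the points of $D$, then $C$, then $B$ receive the next labels in order). Then $\Phi(P,\gamma)=\phi\,\beta_P\,\phi^{ -1}$. -}

module Defs where

open import Data.Nat using (ℕ; zero; suc; _+_; _*_; _∸_; _≤_; _<_; _≤ᵇ_; _<ᵇ_; _≡ᵇ_)
open import Data.Bool using (Bool; true; false; if_then_else_; _∧_)
open import Data.Maybe using (Maybe; just; nothing)
open import Data.Product using (_×_; ∃-syntax)
open import Data.Sum using (_⊎_)
open import Relation.Binary.PropositionalEquality using (_≡_; _≢_)

-- Conventions: the ground set is {1,…,n} ⊆ ℕ.  A permutation of {1,…,n}
-- is represented by a function ℕ → ℕ (only its values on 1..n matter).

_∘ₚ_ : (ℕ → ℕ) → (ℕ → ℕ) → (ℕ → ℕ)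
(f ∘ₚ g) x = f (g x)

iter : (ℕ → ℕ) → ℕ → ℕ → ℕ
iter f zero    x = x
iter f (suc m) x = f (iter f m x)

allBelow : ℕ → (ℕ → Bool) → Bool
allBelow zero    p = true
allBelow (suc m) p = allBelow m p ∧ p m

countFrom : (ℕ → Bool) → ℕ → ℕ → ℕ
countFrom p a zero      = 0
countFrom p a (suc len) = (if p a then 1 else 0) + countFrom p (suc a) len

searchFrom : (ℕ → Bool) → ℕ → ℕ → Maybe ℕ
searchFrom p a zero      = nothing
searchFrom p a (suc len) = if p a then just a else searchFrom p (suc a) len

-- x is the least element of its cycle under f (orbit of x inside {1..n}
-- has at most n elements, so iterating n times covers it)
isCycleMin : ℕ → (ℕ → ℕ) → ℕ → Bool
isCycleMin n f x = allBelow n (λ m → x ≤ᵇ iter f m x)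

-- z(π): number of cycles of a permutation π of {1..n}
-- (each cycle counted once, via its least element)
z : ℕ → (ℕ → ℕ) → ℕ
z n f = countFrom (isCycleMin n f) 1 n

inv : ℕ → (ℕ → ℕ) → (ℕ → ℕ)
inv n α y with searchFrom (λ x → α x ≡ᵇ y) 1 n
... | just x  = x
... | nothing = y

ζ : ℕ → ℕ → ℕ
ζ n x = if x <ᵇ n then suc x else 1

HasGenus : ℕ → (ℕ → ℕ) → ℕ → Set
HasGenus n α g = z n α + z n (inv n α ∘ₚ ζ n) + 2 * g ≡ n + 1

-- A set partition P of {1..n} is given by a block-labelling lab : ℕ → ℕ;
-- x, y ∈ {1..n} lie in the same block iff lab x ≡ lab y.
InRange : ℕ → ℕ → Set
InRange n x = 1 ≤ x × x ≤ n

NonCrossing : ℕ → (ℕ → ℕ) → Set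
NonCrossing n lab = ∀ a b a' b' → 1 ≤ a → a < b → b < a' → a' < b' → b' ≤ n →
  lab a ≡ lab a' → lab b ≡ lab b' → lab a ≡ lab b

-- β_P: each block is a cycle written in increasing order
β : ℕ → (ℕ → ℕ) → ℕ → ℕ
β n lab x with searchFrom (λ y → lab y ≡ᵇ lab x) (suc x) (n ∸ x)
... | just y  = y
... | nothing with searchFrom (λ y → lab y ≡ᵇ lab x) 1 n
...   | just y  = y
...   | nothing = x

data Color : Set where
  cA cB cC cD : Color

color : ℕ → ℕ → ℕ → ℕ → ℕ → Color
color i j k ℓ x =
  if x ≤ᵇ i then cA else
  if x ≤ᵇ j then cB else
  if x ≤ᵇ k then cC else
  if x ≤ᵇ ℓ then cD else cA

φ : ℕ → ℕ → ℕ → ℕ → ℕ → ℕ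
φ i j k ℓ x with color i j k ℓ x
... | cA = x
... | cB = x + ℓ ∸ j
... | cC = x + i + ℓ ∸ j ∸ k
... | cD = x + i ∸ k

Φ : ℕ → (ℕ → ℕ) → ℕ → ℕ → ℕ → ℕ → (ℕ → ℕ)
Φ n lab i j k ℓ = φ i j k ℓ ∘ₚ (β n lab ∘ₚ inv n (φ i j k ℓ))

Meets : ℕ → (ℕ → ℕ) → ℕ → ℕ → ℕ → ℕ → ℕ → Color → Set
Meets n lab i j k ℓ a X = ∃[ x ] (InRange n x × lab x ≡ lab a × color i j k ℓ x ≡ X)

SubsetOf : ℕ → (ℕ → ℕ) → ℕ → ℕ → ℕ → ℕ → ℕ → Color → Color → Set
SubsetOf n lab i j k ℓ a X Y = ∀ x → InRange n x → lab x ≡ lab a →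
  color i j k ℓ x ≡ X ⊎ color i j k ℓ x ≡ Y

Cond1 : ℕ → (ℕ → ℕ) → ℕ → ℕ → ℕ → ℕ → Set
Cond1 n lab i j k ℓ = ∃[ a ] ∃[ X ] ∃[ Y ] ∃[ Z ]
  (InRange n a × X ≢ Y × X ≢ Z × Y ≢ Z ×
   Meets n lab i j k ℓ a X × Meets n lab i j k ℓ a Y × Meets n lab i j k ℓ a Z)

Cond2 : ℕ → (ℕ → ℕ) → ℕ → ℕ → ℕ → ℕ → Set
Cond2 n lab i j k ℓ = ∃[ a ] ∃[ b ] ∃[ X ] ∃[ Y ] ∃[ Z ]
  (InRange n a × InRange n b × lab a ≢ lab b ×
   X ≢ Y × X ≢ Z × Y ≢ Z ×
   Meets n lab i j k ℓ a X × Meets n lab i j k ℓ a Y × SubsetOf n lab i j k ℓ a X Y ×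
   Meets n lab i j k ℓ b X × Meets n lab i j k ℓ b Z × SubsetOf n lab i j k ℓ b X Z)

{-# OPTIONS --safe #-}
module Submission where

-- Let K = β_P⁻¹ζ.  Conjugating by φ, the genus of Φ(P,γ) is read off z(β_P) + z(K τ) with
-- τ = (i k)(j ℓ), because φ⁻¹ζφ = ζτ.  For noncrossing P every block c yields a K-invariant
-- function, sending x to the last point of c weakly before x in cyclic order; it shows that
-- z(β_P) + z(K) = n + 1.  Multiplying a permutation by (a b) lowers the number of cycles by one
-- if some invariant function separates a and b, and raises it by one if this holds for the product.
-- If some color X is joined by blocks to two other colors Y and Z, the invariants of these
-- blocks show that both transpositions of τ join cycles of K, so the genus is 1; this is the case
-- iff (1) or (2) holds.  Otherwise the pairs of colors joined by blocks are pairwise disjoint, and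
-- not both AC and BD occur; then one of (i,k], (j,ℓ], or both (i,j] and (k,ℓ], or both (j,k] and
-- (i,ℓ], are unions of blocks, their indicator functions are invariant after splitting K, and
-- z(K τ) = z(K), so the genus is 0.

-- Origin of τ: φ lines up A, D, C, B, so in the new order `i` is followed by `ζ k`, `ℓ` by `ζ j`,
-- `k` by `ζ i` and `j` by `ζ ℓ`. If C is empty, then j = k, the two transpositions share a point
-- and no longer commute, and τ is a 3-cycle; the case distinctions on `j ≟ k` come from this.
--
-- An invariant can certify only that two points lie in different cycles. That they lie in the same
-- cycle is certified by an invariant of the product with their transposition. The obstacle is genus
-- 0 when only (i,j] and (k,ℓ], or only (j,k] and (i,ℓ], are known to be unions of blocks: these
-- pairs of points are not the transpositions of τ. The identity (a c)(b d) = (a b)(c d)(a d)(b c)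
-- then trades τ for two splits and two joins, all certified by the indicator functions.

open import Defs
open import Data.Nat
  using (ℕ; zero; suc; _+_; _*_; _∸_; _≤_; _<_; _≤ᵇ_; _<ᵇ_; _≡ᵇ_; z≤n; s≤s; pred; _%_; _/_)
open import Data.Nat.Properties
open import Data.Nat.DivMod using (m≡m%n+[m/n]*n; m%n<n)
open import Data.Nat.Induction using (<-rec)
open import Data.Nat.Tactic.RingSolver using (solve-∀)
open import Data.Bool using (Bool; true; false; if_then_else_; _∧_; _∨_; not; T)
import Data.Bool.Properties as Bool
open import Data.Fin using (Fin; toℕ; fromℕ<)
import Data.Fin.Properties as Fin
open import Data.Maybe using (Maybe; just; nothing)
open import Data.Product using (_×_; _,_; proj₁; proj₂; ∃; ∃-syntax)
open import Data.Product.Properties using (≡-dec)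
open import Data.Sum using (_⊎_; inj₁; inj₂; [_,_]′)
open import Function using (_∘_; id)
open import Function.Bundles using (_⇔_; mk⇔)
open import Relation.Nullary using (¬_; Dec; yes; no; contradiction; ¬?; _×-dec_; _→-dec_)
open import Relation.Nullary.Decidable using (dec-true; dec-false; map′; from-yes)
open import Relation.Binary.PropositionalEquality
open import Relation.Binary.Definitions using (tri<; tri≈; tri>; DecidableEquality)

-- Boolean comparisons

true≢false : true ≢ false
true≢false ()

≤ᵇ-true : ∀ {m n} → m ≤ n → (m ≤ᵇ n) ≡ true
≤ᵇ-true {m} {n} = dec-true (m ≤? n)

≤ᵇ-false : ∀ {m n} → n < m → (m ≤ᵇ n) ≡ false
≤ᵇ-false {m} {n} n<m = dec-false (m ≤? n) (<⇒≱ n<m)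

≤ᵇ-true⁻ : ∀ {m n} → (m ≤ᵇ n) ≡ true → m ≤ n
≤ᵇ-true⁻ {m} {n} e = ≤ᵇ⇒≤ m n (subst T (sym e) _)

≤ᵇ-false⁻ : ∀ {m n} → (m ≤ᵇ n) ≡ false → n < m
≤ᵇ-false⁻ e = ≰⇒> λ m≤n → true≢false (trans (sym (≤ᵇ-true m≤n)) e)

<ᵇ-true : ∀ {m n} → m < n → (m <ᵇ n) ≡ true
<ᵇ-true = ≤ᵇ-true

<ᵇ-false : ∀ {m n} → n ≤ m → (m <ᵇ n) ≡ false
<ᵇ-false n≤m = ≤ᵇ-false (s≤s n≤m)

≡ᵇ-true : ∀ {m n} → m ≡ n → (m ≡ᵇ n) ≡ true
≡ᵇ-true {m} {n} = dec-true (m ≟ n)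

≡ᵇ-false : ∀ {m n} → m ≢ n → (m ≡ᵇ n) ≡ false
≡ᵇ-false {m} {n} = dec-false (m ≟ n)

≡ᵇ-true⁻ : ∀ {m n} → (m ≡ᵇ n) ≡ true → m ≡ n
≡ᵇ-true⁻ {m} {n} e = ≡ᵇ⇒≡ m n (subst T (sym e) _)

≡ᵇ-false⁻ : ∀ {m n} → (m ≡ᵇ n) ≡ false → m ≢ n
≡ᵇ-false⁻ {m} e refl = true≢false (trans (sym (≡ᵇ-true {m} refl)) e)

-- Counting

countFrom-cong : ∀ {p q} a len → (∀ x → a ≤ x → x < a + len → p x ≡ q x) →
                 countFrom p a len ≡ countFrom q a len
countFrom-cong a zero    p≗q = refl
countFrom-cong a (suc len) p≗q =
  cong₂ (λ b c → (if b then 1 else 0) + c)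
    (p≗q a ≤-refl (m<m+n a (s≤s z≤n)))
    (countFrom-cong (suc a) len λ x a<x x<t →
      p≗q x (<⇒≤ a<x) (subst (x <_) (sym (+-suc a len)) x<t))

without : ℕ → (ℕ → Bool) → ℕ → Bool
without y q x = q x ∧ not (x ≡ᵇ y)

without-true : ∀ q x {y} → q x ≡ true → x ≢ y → without y q x ≡ true
without-true q x qx x≢y rewrite qx | ≡ᵇ-false x≢y = refl

without-true⁻ : ∀ q x {y} → without y q x ≡ true → q x ≡ true × x ≢ y
without-true⁻ q x {y} w with q x | x ≡ᵇ y in e
... | true | false = refl , ≡ᵇ-false⁻ e

countFrom-remove : ∀ q {y} a len → a ≤ y → y < a + len → q y ≡ true →
                   countFrom q a len ≡ suc (countFrom (without y q) a len)
countFrom-remove q a zero a≤y y<a _ =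
  contradiction (subst (_ <_) (+-identityʳ a) y<a) (≤⇒≯ a≤y)
countFrom-remove q {y} a (suc len) a≤y y<t qy with a ≟ y
... | yes refl rewrite qy | ≡ᵇ-true {a} refl =
  cong suc (countFrom-cong (suc a) len λ x a<x _ → sym (drop x a<x))
  where
  drop : ∀ x → a < x → without a q x ≡ q x
  drop x a<x rewrite ≡ᵇ-false (>⇒≢ a<x) = Bool.∧-identityʳ (q x)
... | no a≢y rewrite ≡ᵇ-false a≢y | Bool.∧-identityʳ (q a) =
  trans (cong ((if q a then 1 else 0) +_)
          (countFrom-remove q (suc a) len (≤∧≢⇒< a≤y a≢y) (subst (y <_) (+-suc a len) y<t) qy))
        (+-suc _ _)

-- Induction on the source interval: the image chosen for its first point is deleted from `q`, and
-- injectivity keeps the later points away from it. A relation takes the place of a function because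
-- images are only known to exist; in the applications it is reachability.
countFrom-injection :
  (R : ℕ → ℕ → Set) → ∀ {p q} a len b m →
  (∀ x → a ≤ x → x < a + len → p x ≡ true →
    ∃[ y ] (b ≤ y × y < b + m × q y ≡ true × R x y)) →
  (∀ {x x′ y} → a ≤ x → x < a + len → p x ≡ true →
    a ≤ x′ → x′ < a + len → p x′ ≡ true → R x y → R x′ y → x ≡ x′) →
  countFrom p a len ≤ countFrom q b m
countFrom-injection R a zero b m total inj = z≤n
countFrom-injection R {p} {q} a (suc len) b m total inj with p a in pa
... | false =
  countFrom-injection R (suc a) len b m
    (λ x a<x x<t → total x (<⇒≤ a<x) (up x<t))
    (λ a<x x<t px a<x′ x′<t → inj (<⇒≤ a<x) (up x<t) px (<⇒≤ a<x′) (up x′<t))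
  where
  up : ∀ {x} → x < suc a + len → x < a + suc len
  up {x} = subst (x <_) (sym (+-suc a len))
... | true with total a ≤-refl (m<m+n a (s≤s z≤n)) pa
... | y , b≤y , y<t , qy , Ray rewrite countFrom-remove q b m b≤y y<t qy =
  s≤s (countFrom-injection R (suc a) len b m
    total′
    (λ a<x x<t px a<x′ x′<t → inj (<⇒≤ a<x) (up x<t) px (<⇒≤ a<x′) (up x′<t)))
  where
  up : ∀ {x} → x < suc a + len → x < a + suc len
  up {x} = subst (x <_) (sym (+-suc a len))
  total′ : ∀ x → suc a ≤ x → x < suc a + len → p x ≡ true →
    ∃[ y′ ] (b ≤ y′ × y′ < b + m × without y q y′ ≡ true × R x y′)
  total′ x a<x x<t px with total x (<⇒≤ a<x) (up x<t) px
  ... | y′ , b≤y′ , y′<t , qy′ , Rxy′ = y′ , b≤y′ , y′<t , without-true q y′ qy′ y′≢y , Rxy′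
    where
    y′≢y : y′ ≢ y
    y′≢y refl = <⇒≢ a<x (inj ≤-refl (m<m+n a (s≤s z≤n)) pa (<⇒≤ a<x) (up x<t) px Ray Rxy′)

-- Orbits

-- The inverse is a field, so composites are inverted without search. All laws are confined to
-- {1,...,n}, since values elsewhere are arbitrary.
record Perm (n : ℕ) (f : ℕ → ℕ) : Set where
  field
    inverse       : ℕ → ℕ
    range         : ∀ {x} → InRange n x → InRange n (f x)
    inverse-range : ∀ {x} → InRange n x → InRange n (inverse x)
    f-inverse     : ∀ {x} → InRange n x → f (inverse x) ≡ x
    inverse-f     : ∀ {x} → InRange n x → inverse (f x) ≡ x

  injective : ∀ {x y} → InRange n x → InRange n y → f x ≡ f y → x ≡ y
  injective rx ry e = trans (sym (inverse-f rx)) (trans (cong inverse e) (inverse-f ry))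

  iter-range : ∀ m {x} → InRange n x → InRange n (iter f m x)
  iter-range zero    rx = rx
  iter-range (suc m) rx = range (iter-range m rx)

  iter-injective : ∀ m {x y} → InRange n x → InRange n y → iter f m x ≡ iter f m y → x ≡ y
  iter-injective zero    rx ry e = e
  iter-injective (suc m) rx ry e =
    iter-injective m rx ry (injective (iter-range m rx) (iter-range m ry) e)

open Perm

∘ₚ-perm : ∀ {n f g} → Perm n f → Perm n g → Perm n (f ∘ₚ g)
∘ₚ-perm {f = f} P Q = record
  { inverse       = inverse Q ∘ inverse P
  ; range         = range P ∘ range Q
  ; inverse-range = inverse-range Q ∘ inverse-range P
  ; f-inverse     = λ r → trans (cong f (f-inverse Q (inverse-range P r))) (f-inverse P r)
  ; inverse-f     = λ r → trans (cong (inverse Q) (inverse-f P (range Q r))) (inverse-f Q r)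
  }

inverse-perm : ∀ {n f} (P : Perm n f) → Perm n (inverse P)
inverse-perm {f = f} P = record
  { inverse = f ; range = inverse-range P ; inverse-range = range P
  ; f-inverse = inverse-f P ; inverse-f = f-inverse P }

id-perm : ∀ {n} → Perm n id
id-perm = record
  { inverse = id ; range = id ; inverse-range = id ; f-inverse = λ _ → refl ; inverse-f = λ _ → refl }

perm-cong : ∀ {n f g} → (∀ {x} → InRange n x → f x ≡ g x) → Perm n f → Perm n g
perm-cong {n} f≗g P = record
  { inverse       = inverse P
  ; range         = λ r → subst (InRange n) (f≗g r) (range P r)
  ; inverse-range = inverse-range P
  ; f-inverse     = λ r → trans (sym (f≗g (inverse-range P r))) (f-inverse P r)
  ; inverse-f     = λ r → trans (cong (inverse P) (sym (f≗g r))) (inverse-f P r)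
  }

iter-+ : ∀ f m k x → iter f (m + k) x ≡ iter f m (iter f k x)
iter-+ f zero    k x = refl
iter-+ f (suc m) k x = cong f (iter-+ f m k x)

iter-* : ∀ f p m {x} → iter f p x ≡ x → iter f (m * p) x ≡ x
iter-* f p zero    e = refl
iter-* f p (suc m) {x} e = trans (iter-+ f p (m * p) x) (trans (cong (iter f p) (iter-* f p m e)) e)

Reach : (ℕ → ℕ) → ℕ → ℕ → Set
Reach f x y = ∃[ m ] iter f m x ≡ y

reach-refl : ∀ {f x} → Reach f x x
reach-refl = 0 , refl

reach-≡ : ∀ {f x y} → x ≡ y → Reach f x y
reach-≡ e = 0 , e

reach-step : ∀ {f x} → Reach f x (f x)
reach-step = 1 , refl

reach-trans : ∀ {f x y w} → Reach f x y → Reach f y w → Reach f x w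
reach-trans {f} {x} (m , p) (k , q) = k + m , trans (iter-+ f k m x) (trans (cong (iter f k) p) q)

module _ {n f} (P : Perm n f) where

  -- Pigeonhole: two of the iterates 0, ..., n agree, and cancelling the earlier one leaves a return
  -- to x. The bound n is what makes the n tests in `isCycleMin` exhaustive.
  period : ∀ {x} → InRange n x → ∃[ p ] (suc p ≤ n × iter f (suc p) x ≡ x)
  period {x} rx with Fin.pigeonhole {m = n} (n<1+n n) index
    where
    index : Fin (suc n) → Fin n
    index t = fromℕ< {pred (iter f (toℕ t) x)} (pred< (iter-range P (toℕ t) rx))
      where
      pred< : ∀ {y} → InRange n y → pred y < n
      pred< {suc y} (_ , y<n) = y<n
  ... | s , t , s<t , e = decompose (m≤n⇒∃[o]m+o≡n s<t)
    where
    a = toℕ s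
    b = toℕ t
    suc-pred′ : ∀ {y} → InRange n y → suc (pred y) ≡ y
    suc-pred′ {suc y} _ = refl
    collide : iter f a x ≡ iter f b x
    collide = trans (sym (suc-pred′ (iter-range P a rx)))
      (trans (cong suc (Fin.fromℕ<-injective _ _ _ _ e)) (suc-pred′ (iter-range P b rx)))
    decompose : (∃[ p ] suc a + p ≡ b) → ∃[ p ] (suc p ≤ n × iter f (suc p) x ≡ x)
    decompose (p , q) =
      p ,
      ≤-trans (m≤n+m (suc p) a) (subst (_≤ n) (trans (sym q) (sym (+-suc a p))) (≤-pred (Fin.toℕ<n t))) ,
      sym (iter-injective P a rx (iter-range P (suc p) rx)
        (trans collide (trans (cong (λ m → iter f m x) (trans (sym q) (sym (+-suc a p)))) (iter-+ f a (suc p) x))))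

  reach-range : ∀ {x y} → InRange n x → Reach f x y → InRange n y
  reach-range rx (m , refl) = iter-range P m rx

  -- If p + 1 steps return to x, then m steps followed by m · p more are m full turns.
  reach-sym : ∀ {x y} → InRange n x → Reach f x y → Reach f y x
  reach-sym {x} rx (m , refl) with period rx
  ... | p , _ , e = m * p , (begin
    iter f (m * p) (iter f m x) ≡⟨ iter-+ f (m * p) m x ⟨
    iter f (m * p + m) x        ≡⟨ cong (λ k → iter f k x) (trans (+-comm (m * p) m) (sym (*-suc m p))) ⟩
    iter f (m * suc p) x        ≡⟨ iter-* f (suc p) m e ⟩
    x ∎)
    where open ≡-Reasoning

  reach-bounded : ∀ {x y} → InRange n x → Reach f x y → ∃[ m ] (m < n × iter f m x ≡ y)
  reach-bounded {x} rx (m , refl) with period rx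
  ... | p , p<n , e = m % suc p , ≤-trans (m%n<n m (suc p)) p<n , (begin
    iter f (m % suc p) x                            ≡⟨ cong (iter f (m % suc p)) (iter-* f (suc p) (m / suc p) e) ⟨
    iter f (m % suc p) (iter f (m / suc p * suc p) x) ≡⟨ iter-+ f (m % suc p) _ x ⟨
    iter f (m % suc p + m / suc p * suc p) x        ≡⟨ cong (λ k → iter f k x) (m≡m%n+[m/n]*n m (suc p)) ⟨
    iter f m x ∎)
    where open ≡-Reasoning

-- Cycle minima and systems of representatives

allBelow-true : ∀ n p → (∀ m → m < n → p m ≡ true) → allBelow n p ≡ true
allBelow-true zero    p h = refl
allBelow-true (suc n) p h
  rewrite allBelow-true n p (λ m m<n → h m (<-trans m<n (n<1+n n))) = h n (n<1+n n)

allBelow-true⁻ : ∀ n p → allBelow n p ≡ true → ∀ m → m < n → p m ≡ true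
allBelow-true⁻ (suc n) p e m m≤n with allBelow n p in eb | p n in en
... | true | true with m ≟ n
...   | yes refl = en
...   | no m≢n   = allBelow-true⁻ n p eb m (≤∧≢⇒< (≤-pred m≤n) m≢n)

allBelow-false⁻ : ∀ n p → allBelow n p ≡ false → ∃[ m ] p m ≡ false
allBelow-false⁻ (suc n) p e with allBelow n p in eb | p n in en
... | true  | false = n , en
... | false | _     = allBelow-false⁻ n p eb

module _ {n f} (P : Perm n f) where

  isCycleMin-true : ∀ {x} → (∀ {y} → Reach f x y → x ≤ y) → isCycleMin n f x ≡ true
  isCycleMin-true least = allBelow-true n _ λ m _ → ≤ᵇ-true (least (m , refl))

  isCycleMin-true⁻ : ∀ {x} → InRange n x → isCycleMin n f x ≡ true → ∀ {y} → Reach f x y → x ≤ y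
  isCycleMin-true⁻ rx e r with reach-bounded P rx r
  ... | m , m<n , refl = ≤ᵇ-true⁻ (allBelow-true⁻ n _ e m m<n)

  cycleMin : ∀ {x} → InRange n x →
             ∃[ y ] (InRange n y × isCycleMin n f y ≡ true × Reach f x y)
  cycleMin {x} = <-rec Goal descend x
    where
    Goal : ℕ → Set
    Goal x = InRange n x → ∃[ y ] (InRange n y × isCycleMin n f y ≡ true × Reach f x y)
    descend : ∀ x → (∀ {y} → y < x → Goal y) → Goal x
    descend x rec rx with isCycleMin n f x in e
    ... | true  = x , rx , e , reach-refl
    ... | false with allBelow-false⁻ n _ e
    ...   | m , em with rec (≤ᵇ-false⁻ em) (iter-range P m rx)
    ...     | y , ry , ey , r = y , ry , ey , reach-trans (m , refl) r

  cycleMin-unique : ∀ {x y} → InRange n x → InRange n y →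
                    isCycleMin n f x ≡ true → isCycleMin n f y ≡ true → Reach f x y → x ≡ y
  cycleMin-unique rx ry ex ey r =
    ≤-antisym (isCycleMin-true⁻ rx ex r) (isCycleMin-true⁻ ry ey (reach-sym P rx r))

-- A decidable transversal of the orbits. Cycles can then be counted by whichever points are
-- convenient: block maxima for `β`, the old minima less one after a join.
record Representatives (n : ℕ) (f : ℕ → ℕ) (p : ℕ → Bool) : Set where
  field
    cover  : ∀ {x} → InRange n x → ∃[ y ] (InRange n y × p y ≡ true × Reach f x y)
    unique : ∀ {x y} → InRange n x → InRange n y → p x ≡ true → p y ≡ true → Reach f x y → x ≡ y

open Representatives

cycleMin-representatives : ∀ {n f} → Perm n f → Representatives n f (isCycleMin n f)
cycleMin-representatives P = record { cover = cycleMin P ; unique = cycleMin-unique P }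

module _ {n f} (P : Perm n f) where

  representatives-≤ : ∀ {p q} → Representatives n f p → Representatives n f q →
                      countFrom p 1 n ≤ countFrom q 1 n
  representatives-≤ Rp Rq = countFrom-injection (Reach f) 1 n 1 n
    (λ x 1≤x x≤n _ → let y , (1≤y , y≤n) , qy , r = cover Rq (1≤x , ≤-pred x≤n) in
                     y , 1≤y , s≤s y≤n , qy , r)
    (λ 1≤x x≤n px 1≤x′ x′≤n px′ r r′ →
      unique Rp (1≤x , ≤-pred x≤n) (1≤x′ , ≤-pred x′≤n) px px′
        (reach-trans r (reach-sym P (1≤x′ , ≤-pred x′≤n) r′)))

  representatives-count : ∀ {p} → Representatives n f p → countFrom p 1 n ≡ z n f
  representatives-count Rp = ≤-antisym
    (representatives-≤ Rp (cycleMin-representatives P))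
    (representatives-≤ (cycleMin-representatives P) Rp)

module _ {n f g} (P : Perm n f) (Q : Perm n g) {h} (C : Perm n h)
         (fh≗hg : ∀ {x} → InRange n x → f (h x) ≡ h (g x)) where

  iter-conj : ∀ m {x} → InRange n x → iter f m (h x) ≡ h (iter g m x)
  iter-conj zero    rx = refl
  iter-conj (suc m) rx = trans (cong f (iter-conj m rx)) (fh≗hg (iter-range Q m rx))

  -- A minimum x of a g-cycle is matched with the minimum of the f-cycle through `h x`. Equal
  -- matches mean f-connected images, and `h` reflects this to g.
  z-conj-≤ : z n g ≤ z n f
  z-conj-≤ = countFrom-injection (λ x y → Reach f (h x) y) 1 n 1 n
    (λ x 1≤x x≤n _ → let y , (1≤y , y≤n) , ey , r = cycleMin P (range C (1≤x , ≤-pred x≤n)) in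
                     y , 1≤y , s≤s y≤n , ey , r)
    (λ 1≤x x≤n ex 1≤x′ x′≤n ex′ r r′ →
      let rx = 1≤x , ≤-pred x≤n ; rx′ = 1≤x′ , ≤-pred x′≤n in
      cycleMin-unique Q rx rx′ ex ex′ (reflect rx rx′ (reach-trans r (reach-sym P (range C rx′) r′))))
    where
    reflect : ∀ {x y} → InRange n x → InRange n y → Reach f (h x) (h y) → Reach g x y
    reflect rx ry (m , e) = m , injective C (iter-range Q m rx) ry (trans (sym (iter-conj m rx)) e)

z-conj : ∀ {n f g h} → Perm n f → Perm n g → Perm n h →
         (∀ {x} → InRange n x → f (h x) ≡ h (g x)) → z n f ≡ z n g
z-conj {n} {f} {g} {h} P Q C fh≗hg = ≤-antisym (z-conj-≤ Q P (inverse-perm C) gh⁻≗h⁻f) (z-conj-≤ P Q C fh≗hg)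
  where
  gh⁻≗h⁻f : ∀ {x} → InRange n x → g (inverse C x) ≡ inverse C (f x)
  gh⁻≗h⁻f rx = trans (sym (inverse-f C (range Q (inverse-range C rx))))
    (cong (inverse C) (trans (sym (fh≗hg (inverse-range C rx))) (cong f (f-inverse C rx))))

z-cong : ∀ {n f g} → Perm n f → (∀ {x} → InRange n x → f x ≡ g x) → z n f ≡ z n g
z-cong P f≗g = z-conj P (perm-cong f≗g P) id-perm f≗g

-- Transpositions

tr : ℕ → ℕ → ℕ → ℕ
tr a b x = if x ≡ᵇ a then b else if x ≡ᵇ b then a else x

tr-left : ∀ a b → tr a b a ≡ b
tr-left a b rewrite ≡ᵇ-true {a} refl = refl

tr-right : ∀ a b → tr a b b ≡ a
tr-right a b with b ≟ a
... | yes refl = tr-left a b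
... | no b≢a rewrite ≡ᵇ-false b≢a | ≡ᵇ-true {b} refl = refl

tr-other : ∀ {a b x} → x ≢ a → x ≢ b → tr a b x ≡ x
tr-other x≢a x≢b rewrite ≡ᵇ-false x≢a | ≡ᵇ-false x≢b = refl

data TrView (a b : ℕ) : ℕ → ℕ → Set where
  left  : TrView a b a b
  right : TrView a b b a
  other : ∀ {x} → x ≢ a → x ≢ b → TrView a b x x

trView : ∀ a b x → TrView a b x (tr a b x)
trView a b x with x ≟ a
... | yes refl = subst (TrView a b a) (sym (tr-left a b)) left
... | no x≢a with x ≟ b
...   | yes refl = subst (TrView a b b) (sym (tr-right a b)) right
...   | no x≢b   = subst (TrView a b x) (sym (tr-other x≢a x≢b)) (other x≢a x≢b)

tr-involutive : ∀ a b x → tr a b (tr a b x) ≡ x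
tr-involutive a b x with tr a b x | trView a b x
... | _ | left          = tr-right a b
... | _ | right         = tr-left a b
... | _ | other x≢a x≢b = tr-other x≢a x≢b

tr-sym : ∀ a b x → tr a b x ≡ tr b a x
tr-sym a b x with tr a b x | trView a b x
... | _ | left          = sym (tr-right b a)
... | _ | right         = sym (tr-left b a)
... | _ | other x≢a x≢b = sym (tr-other x≢b x≢a)

tr-injective : ∀ a b {x y} → tr a b x ≡ tr a b y → x ≡ y
tr-injective a b {x} {y} e =
  trans (sym (tr-involutive a b x)) (trans (cong (tr a b) e) (tr-involutive a b y))

tr-conj : ∀ c d a b x → tr c d (tr a b x) ≡ tr (tr c d a) (tr c d b) (tr c d x)
tr-conj c d a b x with tr a b x | trView a b x
... | _ | left          = sym (tr-left (tr c d a) (tr c d b))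
... | _ | right         = sym (tr-right (tr c d a) (tr c d b))
... | _ | other x≢a x≢b = sym (tr-other (x≢a ∘ tr-injective c d) (x≢b ∘ tr-injective c d))

tr-commute : ∀ {a b c d} → a ≢ c → a ≢ d → b ≢ c → b ≢ d →
             ∀ x → tr c d (tr a b x) ≡ tr a b (tr c d x)
tr-commute {a} {b} {c} {d} a≢c a≢d b≢c b≢d x =
  trans (tr-conj c d a b x)
    (cong₂ (λ s t → tr s t (tr c d x)) (tr-other a≢c a≢d) (tr-other b≢c b≢d))

-- Conjugation by (b c) turns (c a) into (b a). This replaces commutation when two transpositions
-- share a point.
tr-rotate : ∀ {a b c} → a ≢ b → a ≢ c → ∀ x → tr a b (tr b c x) ≡ tr b c (tr c a x)
tr-rotate {a} {b} {c} a≢b a≢c x = sym (trans (tr-conj b c c a x)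
  (trans (cong₂ (λ s t → tr s t (tr b c x)) (tr-right b c) (tr-other a≢b a≢c))
         (tr-sym b a (tr b c x))))

-- The products of two disjoint transpositions of {a,b,c,d} form a Klein four-group.
tr-klein : ∀ {a b c d} → a ≢ b → a ≢ c → a ≢ d → b ≢ c → b ≢ d → c ≢ d →
           ∀ x → tr a b (tr c d (tr a d (tr b c x))) ≡ tr a c (tr b d x)
tr-klein {a} {b} {c} {d} a≢b a≢c a≢d b≢c b≢d c≢d x with x ≟ a
... | yes refl
  rewrite tr-other {b} {c} a≢b a≢c | tr-left a d | tr-right c d
        | tr-other {b} {d} a≢b a≢d | tr-left a c = tr-other (≢-sym a≢c) (≢-sym b≢c)
... | no x≢a with x ≟ b
...   | yes refl
  rewrite tr-left b c | tr-other {a} {d} (≢-sym a≢c) c≢d | tr-left c d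
        | tr-left b d | tr-other {a} {c} (≢-sym a≢d) (≢-sym c≢d) =
    tr-other (≢-sym a≢d) (≢-sym b≢d)
...   | no x≢b with x ≟ c
...     | yes refl
  rewrite tr-right b c | tr-other {a} {d} (≢-sym a≢b) b≢d | tr-other {c} {d} b≢c b≢d
        | tr-other {b} {d} (≢-sym b≢c) c≢d | tr-right a c = tr-right a b
...     | no x≢c with x ≟ d
...       | yes refl
  rewrite tr-other {b} {c} (≢-sym b≢d) (≢-sym c≢d) | tr-right a d | tr-other {c} {d} a≢c a≢d
        | tr-right b d | tr-other {a} {c} (≢-sym a≢b) b≢c = tr-left a b
...       | no x≢d
  rewrite tr-other {b} {c} x≢b x≢c | tr-other {a} {d} x≢a x≢d | tr-other {c} {d} x≢c x≢d
        | tr-other {b} {d} x≢b x≢d | tr-other {a} {c} x≢a x≢c = tr-other x≢a x≢b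

tr-perm : ∀ {n a b} → InRange n a → InRange n b → Perm n (tr a b)
tr-perm {n} {a} {b} ra rb = record
  { inverse = tr a b ; range = range′ ; inverse-range = range′
  ; f-inverse = λ _ → tr-involutive a b _ ; inverse-f = λ _ → tr-involutive a b _ }
  where
  range′ : ∀ {x} → InRange n x → InRange n (tr a b x)
  range′ {x} rx with tr a b x | trView a b x
  ... | _ | left      = rb
  ... | _ | right     = ra
  ... | _ | other _ _ = rx

Invariant : ℕ → (ℕ → ℕ) → {X : Set} → (ℕ → X) → Set
Invariant n f h = ∀ {x} → InRange n x → h (f x) ≡ h x

tr-invariant : ∀ {X : Set} (h : ℕ → X) {a b} → h a ≡ h b → ∀ x → h (tr a b x) ≡ h x
tr-invariant h {a} {b} e x with tr a b x | trView a b x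
... | _ | left      = sym e
... | _ | right     = e
... | _ | other _ _ = refl

-- That a and b lie in different orbits, so that f ∘ₚ tr a b joins these two orbits, is
-- witnessed by an invariant h with h a ≢ h b.
module Join {n f} (P : Perm n f) {X : Set} (h : ℕ → X) (inv : Invariant n f h) where

  reach-invariant : ∀ {x y} → InRange n x → Reach f x y → h x ≡ h y
  reach-invariant rx (zero  , refl) = refl
  reach-invariant rx (suc m , refl) =
    trans (reach-invariant rx (m , refl)) (sym (inv (iter-range P m rx)))

  -- The f-path from x to b is also a path of the product: it never visits a, where `h` has another
  -- value, and it is stopped at its first visit to b.
  approach : ∀ {a b} → h a ≢ h b → ∀ m {x} → InRange n x → h x ≡ h b → iter f m x ≡ b →
             Reach (f ∘ₚ tr a b) x b
  approach a≁b zero    rx e p = 0 , p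
  approach {a} {b} a≁b (suc m) {x} rx e p with x ≟ b
  ... | yes x≡b = reach-≡ x≡b
  ... | no  x≢b =
    reach-trans (1 , cong f (tr-other (λ { refl → a≁b e }) x≢b))
      (approach a≁b m (range P rx) (trans (inv rx) e)
        (trans (sym (iter-+ f m 1 x)) (trans (cong (λ k → iter f k x) (+-comm m 1)) p)))

  -- The product sends a to `f b`, from where the old cycle of b leads back to b.
  joined : ∀ {a b} → InRange n b → h a ≢ h b → Reach (f ∘ₚ tr a b) a b
  joined {a} {b} rb a≁b with reach-sym P rb (reach-step {f})
  ... | m , p = reach-trans (1 , cong f (tr-left a b)) (approach a≁b m (range P rb) (inv rb) p)

  module _ {a b} (ra : InRange n a) (rb : InRange n b) (a≁b : h a ≢ h b) where

    f′ : ℕ → ℕ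
    f′ = f ∘ₚ tr a b

    P′ : Perm n f′
    P′ = ∘ₚ-perm P (tr-perm ra rb)

    coarser-step : ∀ {x} → InRange n x → Reach f′ x (f x)
    coarser-step {x} rx with x ≟ a
    ... | yes refl = reach-trans (joined rb a≁b) (1 , cong f (tr-right a b))
    ... | no x≢a with x ≟ b
    ...   | yes refl = reach-trans (reach-sym P′ ra (joined rb a≁b)) (1 , cong f (tr-left a b))
    ...   | no x≢b   = 1 , cong f (tr-other x≢a x≢b)

    coarser : ∀ {x y} → InRange n x → Reach f x y → Reach f′ x y
    coarser rx (zero  , refl) = reach-refl
    coarser rx (suc m , refl) =
      reach-trans (coarser rx (m , refl)) (coarser-step (iter-range P m rx))

    Touched : ℕ → Set
    Touched x = Reach f x a ⊎ Reach f x b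

    reach-back : ∀ {x} → InRange n x → Touched x → Touched (f x)
    reach-back rx = [ inj₁ ∘ reach-trans back , inj₂ ∘ reach-trans back ]′
      where back = reach-sym P rx reach-step

    touched-sym : ∀ {x y} → InRange n x → Reach f x y → Touched y → Touched x
    touched-sym rx r = [ inj₁ ∘ reach-trans r , inj₂ ∘ reach-trans r ]′

    -- Counterpart of `coarser`: only the orbits of a and b are merged. A path can leave its f-orbit
    -- only by stepping on a or b, and from then on both ends lie in these two orbits.
    merged : ∀ {x y} → InRange n x → Reach f′ x y → Reach f x y ⊎ (Touched x × Touched y)
    merged rx (zero  , refl) = inj₁ reach-refl
    merged {x} rx (suc m , refl) = step (iter f′ m x) (iter-range P′ m rx) (merged rx (m , refl))
      where
      jump : ∀ {w v} → InRange n v → Touched w → Touched v →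
             Reach f x w ⊎ (Touched x × Touched w) → Touched x × Touched (f v)
      jump rv tw tv (inj₁ r)        = touched-sym rx r tw , reach-back rv tv
      jump rv tw tv (inj₂ (tx , _)) = tx , reach-back rv tv
      step : ∀ w → InRange n w → Reach f x w ⊎ (Touched x × Touched w) →
             Reach f x (f′ w) ⊎ (Touched x × Touched (f′ w))
      step w rw c with tr a b w | trView a b w
      ... | _ | left      = inj₂ (jump rb (inj₁ reach-refl) (inj₂ reach-refl) c)
      ... | _ | right     = inj₂ (jump ra (inj₂ reach-refl) (inj₁ reach-refl) c)
      ... | _ | other _ _ with c
      ...   | inj₁ r         = inj₁ (reach-trans r reach-step)
      ...   | inj₂ (tx , tw) = inj₂ (tx , reach-back rw tw)

    -- The f-minima stay representatives once the minimum `β′` of the cycle of b is struck out; the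
    -- minimum `α` of the cycle of a represents the merged cycle.
    z-join : suc (z n f′) ≡ z n f
    z-join with cycleMin P ra | cycleMin P rb
    ... | α , rα , minα , a→α | β′ , rβ , minβ , b→β =
      sym (trans (countFrom-remove (isCycleMin n f) 1 n (proj₁ rβ) (s≤s (proj₂ rβ)) minβ)
        (cong suc (representatives-count P′ record { cover = cover′ ; unique = unique′ })))
      where
      p : ℕ → Bool
      p = without β′ (isCycleMin n f)
      α≢β : α ≢ β′
      α≢β refl = a≁b (trans (reach-invariant ra a→α) (sym (reach-invariant rb b→β)))
      cover′ : ∀ {x} → InRange n x → ∃[ y ] (InRange n y × p y ≡ true × Reach f′ x y)
      cover′ rx with cycleMin P rx
      ... | y , ry , miny , x→y with y ≟ β′
      ...   | no y≢β   = y , ry , without-true (isCycleMin n f) y miny y≢β , coarser rx x→y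
      ...   | yes refl = α , rα , without-true (isCycleMin n f) α minα α≢β ,
        reach-trans (coarser rx x→y)
          (reach-trans (reach-sym P′ rb (coarser rb b→β))
            (reach-trans (reach-sym P′ ra (joined rb a≁b)) (coarser ra a→α)))
      touched-min : ∀ x → InRange n x → p x ≡ true → Touched x → x ≡ α
      touched-min x rx px t with without-true⁻ (isCycleMin n f) x px
      touched-min x rx px (inj₁ r) | minx , _   =
        cycleMin-unique P rx rα minx minα (reach-trans r a→α)
      touched-min x rx px (inj₂ r) | minx , x≢β =
        contradiction (cycleMin-unique P rx rβ minx minβ (reach-trans r b→β)) x≢β
      unique′ : ∀ {x y} → InRange n x → InRange n y → p x ≡ true → p y ≡ true → Reach f′ x y → x ≡ y
      unique′ {x} {y} rx ry px py r with merged rx r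
      ... | inj₁ r′        =
        cycleMin-unique P rx ry (proj₁ (without-true⁻ (isCycleMin n f) x px))
          (proj₁ (without-true⁻ (isCycleMin n f) y py)) r′
      ... | inj₂ (tx , ty) = trans (touched-min x rx px tx) (sym (touched-min y ry py ty))

open Join using (z-join)

-- Multiplying the product by (a b) once more gives f back, so this is `z-join` read backwards.
z-split : ∀ {n f a b} → Perm n f → InRange n a → InRange n b →
          ∀ {X : Set} (h : ℕ → X) → Invariant n (f ∘ₚ tr a b) h → h a ≢ h b →
          z n (f ∘ₚ tr a b) ≡ suc (z n f)
z-split {f = f} {a} {b} P ra rb h inv a≁b =
  trans (sym (z-join Q h inv ra rb a≁b))
        (cong suc (sym (z-cong P λ {x} _ → cong f (sym (tr-involutive a b x)))))
  where Q = ∘ₚ-perm P (tr-perm ra rb)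

module _ {n f} (P : Perm n f) {a b c d}
         (ra : InRange n a) (rb : InRange n b) (rc : InRange n c) (rd : InRange n d) where

  -- The invariant that certifies the split by (a c) also separates b from d afterwards, so (b d)
  -- joins and the two changes cancel.
  z-split-join : ∀ {X : Set} (h : ℕ → X) → Invariant n (f ∘ₚ tr a c) h → h a ≢ h c → h b ≢ h d →
                 z n ((f ∘ₚ tr a c) ∘ₚ tr b d) ≡ z n f
  z-split-join h inv a≁c b≁d = suc-injective
    (trans (z-join (∘ₚ-perm P (tr-perm ra rc)) h inv rb rd b≁d) (z-split P ra rc h inv a≁c))

  -- By `tr-klein`, (a c)(b d) = (a b)(c d)(a d)(b c). The first two factors split, by `h₁` and
  -- `h₂`; the last two join, by `h₂` and `h₁`. The equations between values let each invariant
  -- survive the factors multiplied in before its second use.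
  z-split-split-join-join : ∀ {X : Set} (h₁ h₂ : ℕ → X) →
    Invariant n (f ∘ₚ tr a b) h₁ → Invariant n (f ∘ₚ tr c d) h₂ →
    h₁ a ≡ h₁ c → h₁ d ≡ h₁ c → h₁ b ≢ h₁ c →
    h₂ a ≡ h₂ c → h₂ b ≡ h₂ c → h₂ c ≢ h₂ d → a ≢ c →
    z n ((f ∘ₚ tr a c) ∘ₚ tr b d) ≡ z n f
  z-split-split-join-join h₁ h₂ inv₁ inv₂ h₁a≡c h₁d≡c h₁b≢c h₂a≡c h₂b≡c h₂c≢d a≢c =
    suc-injective (suc-injective (begin
      suc (suc (z n ((f ∘ₚ tr a c) ∘ₚ tr b d))) ≡⟨ cong (suc ∘ suc) (z-cong P₄ λ {x} _ → cong f (klein x)) ⟨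
      suc (suc (z n f₄))                        ≡⟨ cong suc (z-join P₃ h₁ inv₁³ rb rc h₁b≢c) ⟩
      suc (z n f₃)                              ≡⟨ z-join P₂ h₂ inv₂² ra rd h₂a≢d ⟩
      z n f₂                                    ≡⟨ z-split P₁ rc rd h₂ inv₂² h₂c≢d ⟩
      suc (z n f₁)                              ≡⟨ cong suc (z-split P ra rb h₁ inv₁ h₁a≢b) ⟩
      suc (suc (z n f)) ∎))
    where
    open ≡-Reasoning
    f₁ f₂ f₃ f₄ : ℕ → ℕ
    f₁ = f ∘ₚ tr a b
    f₂ = f₁ ∘ₚ tr c d
    f₃ = f₂ ∘ₚ tr a d
    f₄ = f₃ ∘ₚ tr b c
    P₁ = ∘ₚ-perm P (tr-perm ra rb)
    P₂ = ∘ₚ-perm P₁ (tr-perm rc rd)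
    P₃ = ∘ₚ-perm P₂ (tr-perm ra rd)
    P₄ = ∘ₚ-perm P₃ (tr-perm rb rc)
    h₁a≢b : h₁ a ≢ h₁ b
    h₁a≢b e = h₁b≢c (trans (sym e) h₁a≡c)
    h₂a≢d : h₂ a ≢ h₂ d
    h₂a≢d e = h₂c≢d (trans (sym h₂a≡c) e)
    a≢b : a ≢ b
    a≢b refl = h₁a≢b refl
    c≢d : c ≢ d
    c≢d refl = h₂c≢d refl
    a≢d : a ≢ d
    a≢d refl = h₂a≢d refl
    b≢c : b ≢ c
    b≢c refl = h₁b≢c refl
    b≢d : b ≢ d
    b≢d refl = h₁b≢c h₁d≡c
    klein = tr-klein a≢b a≢c a≢d b≢c b≢d c≢d
    inv₂² : Invariant n f₂ h₂
    inv₂² {x} rx = begin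
      h₂ (f (tr a b (tr c d x))) ≡⟨ cong (h₂ ∘ f) (tr-commute (≢-sym a≢c) (≢-sym b≢c) (≢-sym a≢d) (≢-sym b≢d) x) ⟩
      h₂ (f (tr c d (tr a b x))) ≡⟨ inv₂ (range (tr-perm ra rb) rx) ⟩
      h₂ (tr a b x)              ≡⟨ tr-invariant h₂ (trans h₂a≡c (sym h₂b≡c)) x ⟩
      h₂ x ∎
    inv₁³ : Invariant n f₃ h₁
    inv₁³ {x} rx = begin
      h₁ (f (tr a b (tr c d (tr a d x)))) ≡⟨ inv₁ (range (tr-perm rc rd) (range (tr-perm ra rd) rx)) ⟩
      h₁ (tr c d (tr a d x))              ≡⟨ tr-invariant h₁ (sym h₁d≡c) (tr a d x) ⟩
      h₁ (tr a d x)                       ≡⟨ tr-invariant h₁ (trans h₁a≡c (sym h₁d≡c)) x ⟩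
      h₁ x ∎

-- Noncrossing partitions and the Kreweras complement

data SearchFrom (p : ℕ → Bool) (a len : ℕ) : Maybe ℕ → Set where
  found  : ∀ {y} → a ≤ y → y < a + len → p y ≡ true →
           (∀ {e} → a ≤ e → e < y → p e ≡ false) → SearchFrom p a len (just y)
  absent : (∀ {e} → a ≤ e → e < a + len → p e ≡ false) → SearchFrom p a len nothing

searchFrom-spec : ∀ p a len → SearchFrom p a len (searchFrom p a len)
searchFrom-spec p a zero =
  absent λ a≤e e<a → contradiction (subst (_ <_) (+-identityʳ a) e<a) (≤⇒≯ a≤e)
searchFrom-spec p a (suc len) with p a in pa
... | true  = found ≤-refl (m<m+n a (s≤s z≤n)) pa λ a≤e e<a → contradiction e<a (≤⇒≯ a≤e)
... | false with searchFrom p (suc a) len | searchFrom-spec p (suc a) len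
...   | _ | found {y} a<y y<t py first =
  found (<⇒≤ a<y) (subst (y <_) (sym (+-suc a len)) y<t) py first′
  where
  first′ : ∀ {e} → a ≤ e → e < y → p e ≡ false
  first′ {e} a≤e e<y with a ≟ e
  ... | yes refl = pa
  ... | no a≢e   = first (≤∧≢⇒< a≤e a≢e) e<y
...   | _ | absent none = absent none′
  where
  none′ : ∀ {e} → a ≤ e → e < a + suc len → p e ≡ false
  none′ {e} a≤e e<t with a ≟ e
  ... | yes refl = pa
  ... | no a≢e   = none (≤∧≢⇒< a≤e a≢e) (subst (e <_) (+-suc a len) e<t)

inv-perm : ∀ {n f} (P : Perm n f) → ∀ {y} → InRange n y → inv n f y ≡ inverse P y
inv-perm {n} {f} P {y} ry
  with searchFrom (λ x → f x ≡ᵇ y) 1 n | searchFrom-spec (λ x → f x ≡ᵇ y) 1 n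
... | just x  | found 1≤x x≤n fx _ =
  trans (sym (inverse-f P (1≤x , ≤-pred x≤n))) (cong (inverse P) (≡ᵇ-true⁻ fx))
... | nothing | absent none with inverse-range P ry
...   | 1≤x , x≤n = contradiction (f-inverse P ry) (≡ᵇ-false⁻ (none 1≤x (s≤s x≤n)))

ζ-last : ∀ n → ζ n n ≡ 1
ζ-last n rewrite <ᵇ-false {n} ≤-refl = refl

ζ-suc : ∀ {n x} → x < n → ζ n x ≡ suc x
ζ-suc x<n rewrite <ᵇ-true x<n = refl

ζ-perm : ∀ n → Perm n (ζ n)
ζ-perm n = record { inverse = ζ⁻¹ ; range = range′ ; inverse-range = ζ⁻¹-range
                  ; f-inverse = right-inverse ; inverse-f = left-inverse }
  where
  ζ⁻¹ : ℕ → ℕ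
  ζ⁻¹ (suc zero)    = n
  ζ⁻¹ (suc (suc x)) = suc x
  ζ⁻¹ zero          = zero
  range′ : ∀ {x} → InRange n x → InRange n (ζ n x)
  range′ {x} (1≤x , x≤n) with x ≟ n
  ... | yes refl = subst (InRange n) (sym (ζ-last n)) (≤-refl , ≤-trans 1≤x x≤n)
  ... | no x≢n   = subst (InRange n) (sym (ζ-suc (≤∧≢⇒< x≤n x≢n))) (s≤s z≤n , ≤∧≢⇒< x≤n x≢n)
  ζ⁻¹-range : ∀ {x} → InRange n x → InRange n (ζ⁻¹ x)
  ζ⁻¹-range {suc zero}    (_ , 1≤n) = 1≤n , ≤-refl
  ζ⁻¹-range {suc (suc x)} (_ , x<n) = s≤s z≤n , <⇒≤ x<n
  right-inverse : ∀ {x} → InRange n x → ζ n (ζ⁻¹ x) ≡ x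
  right-inverse {suc zero}    _         = ζ-last n
  right-inverse {suc (suc x)} (_ , x<n) = ζ-suc x<n
  left-inverse : ∀ {x} → InRange n x → ζ⁻¹ (ζ n x) ≡ x
  left-inverse {x} (1≤x , x≤n) with x ≟ n
  ... | yes refl = cong ζ⁻¹ (ζ-last n)
  left-inverse {suc x} (1≤x , x≤n) | no x≢n = cong ζ⁻¹ (ζ-suc (≤∧≢⇒< x≤n x≢n))

-- The block cycles and their inverse

data Successor (n : ℕ) (lab : ℕ → ℕ) (x y : ℕ) : Set where
  next : x < y → y ≤ n → lab y ≡ lab x → (∀ {e} → x < e → e < y → lab e ≢ lab x) →
         Successor n lab x y
  wrap : 1 ≤ y → y ≤ x → lab y ≡ lab x → (∀ {e} → x < e → e ≤ n → lab e ≢ lab x) →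
         (∀ {e} → 1 ≤ e → e < y → lab e ≢ lab x) → Successor n lab x y

β-successor : ∀ {n} lab {x} → InRange n x → Successor n lab x (β n lab x)
β-successor {n} lab {x} (1≤x , x≤n)
  with searchFrom (λ y → lab y ≡ᵇ lab x) (suc x) (n ∸ x)
     | searchFrom-spec (λ y → lab y ≡ᵇ lab x) (suc x) (n ∸ x)
... | just y  | found x<y y<t ly first =
  next x<y (≤-pred (subst (y <_) (cong suc (m+[n∸m]≡n x≤n)) y<t)) (≡ᵇ-true⁻ ly)
       (λ x<e e<y → ≡ᵇ-false⁻ (first x<e e<y))
... | nothing | absent none
  with searchFrom (λ y → lab y ≡ᵇ lab x) 1 n | searchFrom-spec (λ y → lab y ≡ᵇ lab x) 1 n
...   | just y  | found 1≤y y≤n ly first =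
  wrap 1≤y (≮⇒≥ λ x<y → none′ x<y (≤-pred y≤n) (≡ᵇ-true⁻ ly)) (≡ᵇ-true⁻ ly) none′
       (λ 1≤e e<y → ≡ᵇ-false⁻ (first 1≤e e<y))
  where
  none′ : ∀ {e} → x < e → e ≤ n → lab e ≢ lab x
  none′ {e} x<e e≤n = ≡ᵇ-false⁻ (none x<e (subst (e <_) (cong suc (sym (m+[n∸m]≡n x≤n))) (s≤s e≤n)))
...   | nothing | absent none′ = contradiction refl (≡ᵇ-false⁻ {lab x} {lab x} (none′ 1≤x (s≤s x≤n)))

-- Junk value: last lab c x is 0 if block c has no point in {1,…,x}.
last : (ℕ → ℕ) → ℕ → ℕ → ℕ
last lab c zero    = zero
last lab c (suc x) = if lab (suc x) ≡ᵇ c then suc x else last lab c x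

last-here : ∀ lab {c x} → 1 ≤ x → lab x ≡ c → last lab c x ≡ x
last-here lab {x = suc x} _ lx rewrite ≡ᵇ-true lx = refl

last-skip : ∀ lab {c x} → lab (suc x) ≢ c → last lab c (suc x) ≡ last lab c x
last-skip lab lx rewrite ≡ᵇ-false lx = refl

last-≤ : ∀ lab c x → last lab c x ≤ x
last-≤ lab c zero = z≤n
last-≤ lab c (suc x) with lab (suc x) ≡ᵇ c
... | true  = ≤-refl
... | false = m≤n⇒m≤1+n (last-≤ lab c x)

last-lab : ∀ lab c x → 1 ≤ last lab c x → lab (last lab c x) ≡ c
last-lab lab c (suc x) 1≤l with lab (suc x) ≡ᵇ c in e
... | true  = ≡ᵇ-true⁻ e
... | false = last-lab lab c x 1≤l

last-max : ∀ lab {c e} x → 1 ≤ e → e ≤ x → lab e ≡ c → e ≤ last lab c x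
last-max lab zero 1≤e e≤0 le = contradiction (≤-trans 1≤e e≤0) λ ()
last-max lab {c} {e} (suc x) 1≤e e≤x le with lab (suc x) ≡ᵇ c in eq
... | true  = e≤x
... | false with e ≟ suc x
...   | yes refl = contradiction le (≡ᵇ-false⁻ eq)
...   | no e≢x   = last-max lab x 1≤e (≤-pred (≤∧≢⇒< e≤x e≢x)) le

last-unique : ∀ lab {c m x} → 1 ≤ m → m ≤ x → lab m ≡ c →
              (∀ {e} → m < e → e ≤ x → lab e ≢ c) → last lab c x ≡ m
last-unique lab {c} {m} {x} 1≤m m≤x lm none with m≤n⇒m<n∨m≡n (last-max lab x 1≤m m≤x lm)
... | inj₁ m<l = contradiction (last-lab lab c x (≤-trans (s≤s z≤n) m<l)) (none m<l (last-≤ lab c x))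
... | inj₂ m≡l = sym m≡l

last-none : ∀ lab c x → (∀ {e} → 1 ≤ e → e ≤ x → lab e ≢ c) → last lab c x ≡ 0
last-none lab c x none with last lab c x in e
... | zero  = refl
... | suc m = contradiction (subst (λ l → lab l ≡ c) e (last-lab lab c x (subst (1 ≤_) (sym e) (s≤s z≤n))))
                (none (s≤s z≤n) (subst (_≤ x) e (last-≤ lab c x)))

infix 5 _orElse_

_orElse_ : ℕ → ℕ → ℕ
zero  orElse d = d
suc m orElse d = suc m

orElse-suc : ∀ {m} d → 1 ≤ m → m orElse d ≡ m
orElse-suc {suc m} d _ = refl

orElse-idem : ∀ m → m orElse m ≡ m
orElse-idem zero    = refl
orElse-idem (suc m) = refl

-- The points of block c cut {1,…,n} into cyclic arcs; arc n lab c x is the point of c at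
-- the start of the arc containing x.
arc : ℕ → (ℕ → ℕ) → ℕ → ℕ → ℕ
arc n lab c x = last lab c x orElse last lab c n

module _ {n : ℕ} {lab : ℕ → ℕ} where

  arc-here : ∀ {c x} → 1 ≤ x → lab x ≡ c → arc n lab c x ≡ x
  arc-here {c} {x} 1≤x lx rewrite last-here lab 1≤x lx = orElse-suc (last lab c n) 1≤x

  arc-block : ∀ {c w x} → InRange n w → lab w ≡ c → x ≤ n →
              InRange n (arc n lab c x) × lab (arc n lab c x) ≡ c
  arc-block {c} {w} {x} (1≤w , w≤n) lw x≤n with last lab c x in e
  ... | zero  = (≤-trans 1≤w w≤l , last-≤ lab c n) , last-lab lab c n (≤-trans 1≤w w≤l)
    where w≤l = last-max lab n 1≤w w≤n lw
  ... | suc m = (s≤s z≤n , ≤-trans (subst (_≤ x) e (last-≤ lab c x)) x≤n) ,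
                subst (λ l → lab l ≡ c) e (last-lab lab c x (subst (1 ≤_) (sym e) (s≤s z≤n)))

-- The cyclic predecessor of w in its block starts the arc containing w - 1. For the least point of
-- a block the default in `arc` supplies the greatest one.
β⁻¹ : ℕ → (ℕ → ℕ) → ℕ → ℕ
β⁻¹ n lab w = arc n lab (lab w) (pred w)

module _ {n : ℕ} (lab : ℕ → ℕ) where

  β-range : ∀ {x} → InRange n x → InRange n (β n lab x)
  β-range rx with β-successor lab rx
  ... | next x<y y≤n _ _   = ≤-trans (s≤s z≤n) x<y , y≤n
  ... | wrap 1≤y y≤x _ _ _ = 1≤y , ≤-trans y≤x (proj₂ rx)

  β-lab : ∀ {x} → InRange n x → lab (β n lab x) ≡ lab x
  β-lab rx with β-successor lab rx
  ... | next _ _ ly _   = ly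
  ... | wrap _ _ ly _ _ = ly

  pred≤n : ∀ {w} → InRange n w → pred w ≤ n
  pred≤n (_ , w≤n) = ≤-trans pred[n]≤n w≤n

  β⁻¹-range : ∀ {w} → InRange n w → InRange n (β⁻¹ n lab w)
  β⁻¹-range {w} rw = proj₁ (arc-block {lab = lab} {c = lab w} rw refl (pred≤n rw))

  β⁻¹-lab : ∀ {w} → InRange n w → lab (β⁻¹ n lab w) ≡ lab w
  β⁻¹-lab {w} rw = proj₂ (arc-block {lab = lab} {c = lab w} rw refl (pred≤n rw))

  β⁻¹-β : ∀ {x} → InRange n x → β⁻¹ n lab (β n lab x) ≡ x
  β⁻¹-β {x} rx@(1≤x , x≤n) with β n lab x | β-successor lab rx
  ... | suc y | next x<y y≤n ly none
    rewrite ly | last-unique lab 1≤x (≤-pred x<y) refl (λ x<e e≤y → none x<e (s≤s e≤y)) =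
    orElse-suc (last lab (lab x) n) 1≤x
  ... | suc y | wrap 1≤y y≤x ly none none′
    rewrite ly | last-none lab (lab x) y (λ 1≤e e≤y → none′ 1≤e (s≤s e≤y)) =
    last-unique lab 1≤x x≤n refl none

  β-β⁻¹ : ∀ {w} → InRange n w → β n lab (β⁻¹ n lab w) ≡ w
  β-β⁻¹ {suc w} rw@(1≤w , w≤n) with last lab (lab (suc w)) w in e
  ... | suc m = unique-next (β-successor lab ry)
    where
    c = lab (suc w)
    1≤l : 1 ≤ last lab c w
    1≤l = subst (1 ≤_) (sym e) (s≤s z≤n)
    m<w : suc m ≤ w
    m<w = subst (_≤ w) e (last-≤ lab c w)
    lm : lab (suc m) ≡ c
    lm = subst (λ l → lab l ≡ c) e (last-lab lab c w 1≤l)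
    ry : InRange n (suc m)
    ry = s≤s z≤n , ≤-trans m<w (<⇒≤ w≤n)
    unique-next : ∀ {y} → Successor n lab (suc m) y → y ≡ suc w
    unique-next {y} (next m<y y≤n ly none) with <-cmp y (suc w)
    ... | tri< y<w _ _ = contradiction
      (subst (y ≤_) e (last-max lab w (≤-trans (s≤s z≤n) m<y) (≤-pred y<w) (trans ly lm))) (<⇒≱ m<y)
    ... | tri≈ _ y≡w _ = y≡w
    ... | tri> _ _ w<y = contradiction (sym lm) (none (s≤s m<w) w<y)
    unique-next (wrap _ _ _ none _) = contradiction (sym lm) (none (s≤s m<w) w≤n)
  ... | zero = unique-wrap (β-successor lab ry)
    where
    c = lab (suc w)
    w≤l : suc w ≤ last lab c n
    w≤l = last-max lab n 1≤w w≤n refl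
    1≤l : 1 ≤ last lab c n
    1≤l = ≤-trans 1≤w w≤l
    ll : lab (last lab c n) ≡ c
    ll = last-lab lab c n 1≤l
    ry : InRange n (last lab c n)
    ry = 1≤l , last-≤ lab c n
    unique-wrap : ∀ {y} → Successor n lab (last lab c n) y → y ≡ suc w
    unique-wrap (next l<y y≤n ly _) =
      contradiction (last-max lab n (≤-trans (s≤s z≤n) l<y) y≤n (trans ly ll)) (<⇒≱ l<y)
    unique-wrap {y} (wrap 1≤y y≤l ly _ none) with <-cmp y (suc w)
    ... | tri< y<w _ _ = contradiction
      (≤-trans 1≤y (subst (y ≤_) e (last-max lab w 1≤y (≤-pred y<w) (trans ly ll)))) λ ()
    ... | tri≈ _ y≡w _ = y≡w
    ... | tri> _ _ w<y = contradiction (sym ll) (none 1≤w w<y)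

  β-perm : Perm n (β n lab)
  β-perm = record { inverse = β⁻¹ n lab ; range = β-range ; inverse-range = β⁻¹-range
                  ; f-inverse = β-β⁻¹ ; inverse-f = β⁻¹-β }

  -- Exactly one point of each block is not sent upwards, its greatest. Climbing along `β` reaches
  -- it, with `n ∸ x` as decreasing measure.
  β-representatives : Representatives n (β n lab) (λ x → β n lab x ≤ᵇ x)
  β-representatives = record { cover = λ {x} → climb (n ∸ x) ≤-refl ; unique = unique′ }
    where
    climb : ∀ d {x} → n ∸ x ≤ d → InRange n x →
            ∃[ y ] (InRange n y × (β n lab y ≤ᵇ y) ≡ true × Reach (β n lab) x y)
    climb d {x} n∸x≤d rx with β n lab x ≤ᵇ x in e
    ... | true = x , rx , e , reach-refl
    climb d {x} n∸x≤d rx | false = further d n∸x≤d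
      where
      x<βx : x < β n lab x
      x<βx = ≤ᵇ-false⁻ {β n lab x} e
      suc-∸ : ∀ {m k} → m < k → suc (k ∸ suc m) ≡ k ∸ m
      suc-∸ {m} {suc k} (s≤s m≤k) = sym (+-∸-assoc 1 m≤k)
      further : ∀ d → n ∸ x ≤ d →
                ∃[ y ] (InRange n y × (β n lab y ≤ᵇ y) ≡ true × Reach (β n lab) x y)
      further zero n∸x≤0 =
        contradiction (m∸n≡0⇒m≤n (n≤0⇒n≡0 n∸x≤0)) (<⇒≱ (≤-trans x<βx (proj₂ (β-range rx))))
      further (suc d) n∸x≤d
        with climb d (≤-trans (∸-monoʳ-≤ n x<βx)
               (≤-pred (≤-trans (≤-reflexive (suc-∸ (≤-trans x<βx (proj₂ (β-range rx))))) n∸x≤d)))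
               (β-range rx)
      ... | y , ry , ey , r = y , ry , ey , reach-trans reach-step r
    reach-lab : ∀ {x y} → InRange n x → Reach (β n lab) x y → lab y ≡ lab x
    reach-lab rx (zero  , refl) = refl
    reach-lab rx (suc m , refl) = trans (β-lab (iter-range β-perm m rx)) (reach-lab rx (m , refl))
    top : ∀ {x e} → InRange n x → (β n lab x ≤ᵇ x) ≡ true → InRange n e → lab e ≡ lab x → e ≤ x
    top rx ex re le with β-successor lab rx
    ... | next x<y _ _ _ = contradiction (≤ᵇ-true⁻ ex) (<⇒≱ x<y)
    ... | wrap _ _ _ none _ = ≮⇒≥ λ x<e → none x<e (proj₂ re) le
    unique′ : ∀ {x y} → InRange n x → InRange n y → (β n lab x ≤ᵇ x) ≡ true →
              (β n lab y ≤ᵇ y) ≡ true → Reach (β n lab) x y → x ≡ y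
    unique′ rx ry ex ey r =
      ≤-antisym (top ry ey rx (sym (reach-lab rx r))) (top rx ex ry (reach-lab rx r))

-- Arc invariants and the cycle count of the Kreweras complement

Kreweras : ℕ → (ℕ → ℕ) → ℕ → ℕ
Kreweras n lab = β⁻¹ n lab ∘ₚ ζ n

Kreweras-perm : ∀ n lab → Perm n (Kreweras n lab)
Kreweras-perm n lab = ∘ₚ-perm (inverse-perm (β-perm lab)) (ζ-perm n)

countFrom-complement : ∀ p a len → countFrom p a len + countFrom (not ∘ p) a len ≡ len
countFrom-complement p a zero = refl
countFrom-complement p a (suc len) with p a
... | true  = cong suc (countFrom-complement p (suc a) len)
... | false = trans (+-suc _ _) (cong suc (countFrom-complement p (suc a) len))

last-≤-last : ∀ lab c x y → last lab c x ≤ y → last lab c x ≤ last lab c y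
last-≤-last lab c x y l≤y with last lab c x in e
... | zero  = z≤n
... | suc m = last-max lab y (s≤s z≤n) l≤y
                (subst (λ l → lab l ≡ c) e (last-lab lab c x (subst (1 ≤_) (sym e) (s≤s z≤n))))

module _ {n : ℕ} {lab : ℕ → ℕ} (nc : NonCrossing n lab) where

  -- If c has no point in (x,y], both arcs start alike. Otherwise c has a last point q between x and
  -- y, and noncrossing forbids points of c before x or after y; so x falls back on the greatest
  -- point of c, which is q as well.
  arc-constant-< : ∀ {c x y} → InRange n x → InRange n y → x < y → lab x ≡ lab y → lab x ≢ c →
                   arc n lab c x ≡ arc n lab c y
  arc-constant-< {c} {x} {y} (1≤x , x≤n) (1≤y , y≤n) x<y lx≡ly lx≢c with last lab c y ≤? x
  ... | yes l≤x = cong (_orElse last lab c n) (≤-antisym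
    (last-≤-last lab c x y (≤-trans (last-≤ lab c x) (<⇒≤ x<y))) (last-≤-last lab c y x l≤x))
  ... | no l≰x = trans (cong (_orElse last lab c n) last-x) (trans last-n (sym (orElse-suc _ 1≤q)))
    where
    q = last lab c y
    x<q : x < q
    x<q = ≰⇒> l≰x
    1≤q : 1 ≤ q
    1≤q = ≤-trans 1≤x (<⇒≤ x<q)
    lq : lab q ≡ c
    lq = last-lab lab c y 1≤q
    q<y : q < y
    q<y = ≤∧≢⇒< (last-≤ lab c y) λ q≡y → lx≢c (trans lx≡ly (trans (cong lab (sym q≡y)) lq))
    last-x : last lab c x ≡ 0
    last-x = last-none lab c x λ {e} 1≤e e≤x le → lx≢c (trans
      (sym (nc e x q y 1≤e (≤∧≢⇒< e≤x λ { refl → lx≢c le }) x<q q<y y≤n (trans le (sym lq)) lx≡ly)) le)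
    last-n : last lab c n ≡ q
    last-n = ≤-antisym (last-≤-last lab c n y (≮⇒≥ beyond))
                       (last-≤-last lab c y n (≤-trans (last-≤ lab c y) y≤n))
      where
      beyond : ¬ y < last lab c n
      beyond y<l = lx≢c (trans (nc x q y (last lab c n) 1≤x x<q q<y y<l (last-≤ lab c n) lx≡ly
        (trans lq (sym (last-lab lab c n (≤-trans 1≤y (<⇒≤ y<l)))))) lq)

  arc-constant : ∀ {c x y} → InRange n x → InRange n y → lab x ≡ lab y → lab x ≢ c →
                 arc n lab c x ≡ arc n lab c y
  arc-constant {c} {x} {y} rx ry lx≡ly lx≢c with <-cmp x y
  ... | tri< x<y _ _  = arc-constant-< rx ry x<y lx≡ly lx≢c
  ... | tri≈ _ refl _ = refl
  ... | tri> _ _ y<x  = sym (arc-constant-< ry rx y<x (sym lx≡ly) (lx≢c ∘ trans lx≡ly))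

  -- For w in c both sides are the predecessor of w. For w outside c, `β⁻¹ n lab w` is in the block
  -- of w and so in the same arc, and no new arc starts at w.
  arc-β⁻¹ : ∀ c {w} → InRange n w → arc n lab c (β⁻¹ n lab w) ≡ arc n lab c (pred w)
  arc-β⁻¹ c {suc w} rw with lab (suc w) ≟ c
  ... | yes refl = arc-here {n = n} (proj₁ (β⁻¹-range lab rw)) (β⁻¹-lab lab rw)
  ... | no lw≢c  = trans
    (arc-constant (β⁻¹-range lab rw) rw (β⁻¹-lab lab rw) (lw≢c ∘ trans (sym (β⁻¹-lab lab rw))))
    (cong (_orElse last lab c n) (last-skip lab lw≢c))

  -- Stepping back from `ζ n x` returns to x, except for x = n, where it gives 0; the default in
  -- `arc` makes 0 and n agree.
  arc-invariant : ∀ c → Invariant n (Kreweras n lab) (arc n lab c)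
  arc-invariant c {x} rx@(1≤x , x≤n) =
    trans (arc-β⁻¹ c (range (ζ-perm n) rx)) (before-ζ (x ≟ n))
    where
    before-ζ : Dec (x ≡ n) → arc n lab c (pred (ζ n x)) ≡ arc n lab c x
    before-ζ (yes refl) rewrite ζ-last n = sym (orElse-idem (last lab c n))
    before-ζ (no x≢n) rewrite ζ-suc (≤∧≢⇒< x≤n x≢n) = refl

  private
    -- `drop` marks the block maxima. `wraps` marks the other points and the preimage of 1; these
    -- turn out to be the cycle minima of the complement.
    drop wraps : ℕ → Bool
    drop x = β n lab x ≤ᵇ x
    wraps x = not (drop x) ∨ (β n lab x ≡ᵇ 1)

    -- By invariance y lies in the arc that starts at x. It could precede x only if this arc runs
    -- past n; then x would be the greatest point of its block, and y would precede the whole block.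
    -- The first alternative denies the former, the second the latter.
    kreweras-≥ : ∀ {x} → InRange n x → x < β n lab x ⊎ β n lab x ≡ 1 →
                 ∀ {y} → Reach (Kreweras n lab) x y → x ≤ y
    kreweras-≥ {x} rx@(1≤x , x≤n) cond {y} r = start (last lab c y) refl
      where
      c = lab x
      same-arc : arc n lab c y ≡ x
      same-arc = trans (sym (Join.reach-invariant (Kreweras-perm n lab) (arc n lab c) (arc-invariant c) rx r))
                       (arc-here {n = n} 1≤x refl)
      1≤y : 1 ≤ y
      1≤y = proj₁ (reach-range (Kreweras-perm n lab) rx r)
      start : ∀ l → last lab c y ≡ l → x ≤ y
      start (suc m) e = subst (_≤ y) (trans (sym (orElse-suc (last lab c n) (subst (1 ≤_) (sym e) (s≤s z≤n)))) same-arc)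
                          (last-≤ lab c y)
      start zero e = [ no-drop , no-wrap ]′ cond
        where
        no-drop : x < β n lab x → x ≤ y
        no-drop x<βx = contradiction
          (subst (β n lab x ≤_) (trans (cong (_orElse last lab c n) (sym e)) same-arc)
            (last-max lab n (proj₁ (β-range lab rx)) (proj₂ (β-range lab rx)) (β-lab lab rx)))
          (<⇒≱ x<βx)
        no-wrap : β n lab x ≡ 1 → x ≤ y
        no-wrap βx≡1 = contradiction
          (subst (1 ≤_) e (last-max lab y ≤-refl 1≤y (trans (cong lab (sym βx≡1)) (β-lab lab rx)))) λ ()

    -- The complement sends β(x) - 1 to x, and here this is a smaller point of {1,...,n}.
    kreweras-not-min : ∀ {x} → InRange n x → β n lab x ≤ x → β n lab x ≢ 1 →
                       isCycleMin n (Kreweras n lab) x ≡ false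
    kreweras-not-min {x} rx βx≤x βx≢1 with isCycleMin n (Kreweras n lab) x in e
    ... | false = refl
    ... | true  = contradiction βx≤x (<⇒≱ (lower (β n lab x) refl))
      where
      lower : ∀ b → β n lab x ≡ b → x < b
      lower zero             eb = contradiction (subst (1 ≤_) eb (proj₁ (β-range lab rx))) λ ()
      lower (suc zero)       eb = contradiction eb βx≢1
      lower (suc (suc w))    eb = s≤s (isCycleMin-true⁻ (Kreweras-perm n lab) rx e
        (reach-sym (Kreweras-perm n lab) (s≤s z≤n , <⇒≤ w<n) (1 , Kw≡x)))
        where
        w<n : suc w < n
        w<n = subst (_≤ n) eb (proj₂ (β-range lab rx))
        Kw≡x : Kreweras n lab (suc w) ≡ x
        Kw≡x = trans (cong (β⁻¹ n lab) (trans (ζ-suc w<n) (sym eb))) (β⁻¹-β lab rx)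

    kreweras-min : ∀ {x} → InRange n x → isCycleMin n (Kreweras n lab) x ≡ wraps x
    kreweras-min {x} rx with β n lab x ≤ᵇ x in le | β n lab x ≡ᵇ 1 in one
    ... | false | _     = isCycleMin-true (Kreweras-perm n lab) (kreweras-≥ rx (inj₁ (≤ᵇ-false⁻ {β n lab x} le)))
    ... | true  | true  = isCycleMin-true (Kreweras-perm n lab) (kreweras-≥ rx (inj₂ (≡ᵇ-true⁻ one)))
    ... | true  | false = kreweras-not-min rx (≤ᵇ-true⁻ le) (≡ᵇ-false⁻ one)

    wraps-without : 1 ≤ n → ∀ {x} → InRange n x → without (β⁻¹ n lab 1) wraps x ≡ not (drop x)
    wraps-without 1≤n {x} rx with x ≟ β⁻¹ n lab 1
    ... | yes refl rewrite ≡ᵇ-true {β⁻¹ n lab 1} refl | β-β⁻¹ lab {1} (≤-refl , 1≤n)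
                         | ≤ᵇ-true (proj₁ rx) = refl
    ... | no x≢ rewrite ≡ᵇ-false x≢ | ≡ᵇ-false {β n lab x} {1}
                          (λ βx≡1 → x≢ (trans (sym (β⁻¹-β lab rx)) (cong (β⁻¹ n lab) βx≡1)))
                      | Bool.∨-identityʳ (not (drop x)) = Bool.∧-identityʳ (not (drop x))

  -- Block maxima and remaining points add up to n. The greatest point of the block of 1 is counted
  -- in both terms, whence the extra 1.
  z-Kreweras : 1 ≤ n → z n (β n lab) + z n (Kreweras n lab) ≡ suc n
  z-Kreweras 1≤n = begin
    z n (β n lab) + z n (Kreweras n lab)
      ≡⟨ cong₂ _+_ (sym (representatives-count (β-perm {n} lab) (β-representatives lab)))
           (countFrom-cong 1 n λ x 1≤x x≤n → kreweras-min (1≤x , ≤-pred x≤n)) ⟩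
    countFrom drop 1 n + countFrom wraps 1 n
      ≡⟨ cong (countFrom drop 1 n +_) (countFrom-remove wraps 1 n (proj₁ r₁) (s≤s (proj₂ r₁)) w₁) ⟩
    countFrom drop 1 n + suc (countFrom (without (β⁻¹ n lab 1) wraps) 1 n)
      ≡⟨ cong (λ m → countFrom drop 1 n + suc m)
           (countFrom-cong 1 n λ x 1≤x x≤n → wraps-without 1≤n (1≤x , ≤-pred x≤n)) ⟩
    countFrom drop 1 n + suc (countFrom (not ∘ drop) 1 n)
      ≡⟨ +-suc _ _ ⟩
    suc (countFrom drop 1 n + countFrom (not ∘ drop) 1 n)
      ≡⟨ cong suc (countFrom-complement drop 1 n) ⟩
    suc n ∎
    where
    open ≡-Reasoning
    r₁ : InRange n (β⁻¹ n lab 1)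
    r₁ = β⁻¹-range lab (≤-refl , 1≤n)
    w₁ : wraps (β⁻¹ n lab 1) ≡ true
    w₁ rewrite β-β⁻¹ lab {1} (≤-refl , 1≤n) = Bool.∨-zeroʳ _

-- Splitting and joining the cycles of the Kreweras complement

inside : ℕ → ℕ → ℕ → Bool
inside u v x = (u <ᵇ x) ∧ not (v <ᵇ x)

inside-true : ∀ u v {x} → u < x → x ≤ v → inside u v x ≡ true
inside-true u v u<x x≤v rewrite <ᵇ-true u<x | <ᵇ-false x≤v = refl

inside-left : ∀ u v {x} → x ≤ u → inside u v x ≡ false
inside-left u v x≤u rewrite <ᵇ-false x≤u = refl

inside-right : ∀ u v {x} → v < x → inside u v x ≡ false
inside-right u v {x} v<x rewrite <ᵇ-true v<x = Bool.∧-zeroʳ (u <ᵇ x)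

inside-true⁻ : ∀ {u v x} → inside u v x ≡ true → u < x × x ≤ v
inside-true⁻ {u} {v} {x} e with u <ᵇ x in eu | v <ᵇ x in ev
... | true | false = ≤ᵇ-true⁻ eu , ≤-pred (≤ᵇ-false⁻ {suc v} ev)

-- Within {1,...,n}, (u,v] is a union of blocks; `β⁻¹` then preserves it.
NotSeparated : ℕ → (ℕ → ℕ) → ℕ → ℕ → Set
NotSeparated n lab u v = ∀ {x y} → InRange n x → InRange n y → lab x ≡ lab y →
                         inside u v x ≡ inside u v y

-- `ζ` enters (u,v] only from u and leaves it only from v; exchanging u and v first closes both
-- passages.
inside-ζ : ∀ {n u v x} → 1 ≤ u → u < v → v ≤ n → InRange n x →
           inside u v (ζ n (tr u v x)) ≡ inside u v x
inside-ζ {n} {u} {v} {x} 1≤u u<v v≤n (1≤x , x≤n) with tr u v x | trView u v x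
... | _ | left = trans (after-v (v ≟ n)) (sym (inside-left u v ≤-refl))
  where
  after-v : Dec (v ≡ n) → inside u v (ζ n v) ≡ false
  after-v (yes refl) rewrite ζ-last n = inside-left u v 1≤u
  after-v (no v≢n) rewrite ζ-suc (≤∧≢⇒< v≤n v≢n) = inside-right u v ≤-refl
... | _ | right rewrite ζ-suc (<-≤-trans u<v v≤n) =
  trans (inside-true u v ≤-refl u<v) (sym (inside-true u v u<v ≤-refl))
... | _ | other x≢u x≢v with x ≟ n
...   | yes refl rewrite ζ-last n =
  trans (inside-left u v 1≤u) (sym (inside-right u v (≤∧≢⇒< v≤n (≢-sym x≢v))))
...   | no x≢n rewrite ζ-suc (≤∧≢⇒< x≤n x≢n) with <-cmp x u | <-cmp x v
...     | tri< x<u _ _ | _            = trans (inside-left u v x<u) (sym (inside-left u v (<⇒≤ x<u)))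
...     | tri≈ _ x≡u _ | _            = contradiction x≡u x≢u
...     | tri> _ _ u<x | tri< x<v _ _ = trans (inside-true u v (m≤n⇒m≤1+n u<x) x<v) (sym (inside-true u v u<x (<⇒≤ x<v)))
...     | tri> _ _ u<x | tri≈ _ x≡v _ = contradiction x≡v x≢v
...     | tri> _ _ u<x | tri> _ _ v<x = trans (inside-right u v (m≤n⇒m≤1+n v<x)) (sym (inside-right u v v<x))

inside-invariant : ∀ {n lab u v} → 1 ≤ u → u < v → v ≤ n → NotSeparated n lab u v →
                   Invariant n (Kreweras n lab ∘ₚ tr u v) (inside u v)
inside-invariant {n} {lab} {u} {v} 1≤u u<v v≤n ns rx =
  trans (ns (β⁻¹-range lab rζ) rζ (β⁻¹-lab lab rζ)) (inside-ζ 1≤u u<v v≤n rx)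
  where
  rζ = range (∘ₚ-perm (ζ-perm n) (tr-perm (1≤u , <⇒≤ (<-≤-trans u<v v≤n)) (≤-trans 1≤u (<⇒≤ u<v) , v≤n))) rx

-- The point x makes the arc of v start beyond u. As u has the same arc, c has no point up to u, and
-- the start of that arc is the greatest point of c; it is at most v.
arc-separates-true : ∀ {n} lab c {u v x y} → u ≤ v → v ≤ n → arc n lab c u ≡ arc n lab c v →
                     InRange n x → InRange n y → lab x ≡ c → lab y ≡ c →
                     inside u v x ≡ true → inside u v y ≡ true
arc-separates-true {n} lab c {u} {v} {x} {y} u≤v v≤n same (1≤x , x≤n) (1≤y , y≤n) lx ly e
  with inside-true⁻ {u} {v} e
... | u<x , x≤v = from-start (last lab c u) refl
  where
  x≤l : x ≤ last lab c v
  x≤l = last-max lab v 1≤x x≤v lx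
  arc-v : arc n lab c v ≡ last lab c v
  arc-v = orElse-suc (last lab c n) (≤-trans 1≤x x≤l)
  from-start : ∀ l → last lab c u ≡ l → inside u v y ≡ true
  from-start (suc m) el = contradiction
    (subst (_≤ u) (trans (sym (orElse-suc (last lab c n) (subst (1 ≤_) (sym el) (s≤s z≤n)))) (trans same arc-v))
      (last-≤ lab c u))
    (<⇒≱ (<-≤-trans u<x x≤l))
  from-start zero el = inside-true u v
    (≰⇒> λ y≤u → contradiction (subst (1 ≤_) el (≤-trans 1≤y (last-max lab u 1≤y y≤u ly))) λ ())
    (≤-trans (last-max lab n 1≤y y≤n ly)
      (subst (_≤ v) (sym (trans (cong (_orElse last lab c n) (sym el)) (trans same arc-v))) (last-≤ lab c v)))

arc-separates : ∀ {n} lab c {u v x y} → u ≤ v → v ≤ n → arc n lab c u ≡ arc n lab c v →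
                InRange n x → InRange n y → lab x ≡ c → lab y ≡ c → inside u v x ≡ inside u v y
arc-separates lab c {u} {v} {x} {y} u≤v v≤n same rx ry lx ly
  with inside u v x in ex | inside u v y in ey
... | true  | true  = refl
... | false | false = refl
... | true  | false = trans (sym (arc-separates-true lab c u≤v v≤n same rx ry lx ly ex)) ey
... | false | true  = trans (sym ex) (arc-separates-true lab c u≤v v≤n same ry rx ly lx ey)

-- Quotient identifying p and q: composed with it, an invariant survives the join of two cycles with
-- these values.
collapse : ∀ {X : Set} → DecidableEquality X → X → X → X → X
collapse _≟ˣ_ p q y with y ≟ˣ p
... | yes _ = q
... | no  _ = y

collapse-≡ : ∀ {X : Set} (_≟ˣ_ : DecidableEquality X) p q →
             collapse _≟ˣ_ p q p ≡ collapse _≟ˣ_ p q q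
collapse-≡ _≟ˣ_ p q with p ≟ˣ p | q ≟ˣ p
... | yes _  | yes _ = refl
... | yes _  | no _  = refl
... | no p≢p | _     = contradiction refl p≢p

collapse-≢ : ∀ {X : Set} (_≟ˣ_ : DecidableEquality X) {p q s t} → s ≢ t →
             ¬ (s ≡ p × t ≡ q) → ¬ (s ≡ q × t ≡ p) →
             collapse _≟ˣ_ p q s ≢ collapse _≟ˣ_ p q t
collapse-≢ _≟ˣ_ {p} {q} {s} {t} s≢t ¬pq ¬qp with s ≟ˣ p | t ≟ˣ p
... | yes s≡p | yes t≡p = λ _ → s≢t (trans s≡p (sym t≡p))
... | yes s≡p | no  _   = λ q≡t → ¬pq (s≡p , sym q≡t)
... | no  _   | yes t≡p = λ s≡q → ¬qp (s≡q , t≡p)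
... | no  _   | no  _   = s≢t

-- The last two hypotheses say that `h b` and `h d` are not, in either order, the two values
-- identified by the first join. The quotient therefore still separates b from d.
z-join-join : ∀ {n f a b c d} → Perm n f →
  InRange n a → InRange n b → InRange n c → InRange n d →
  ∀ {X : Set} → DecidableEquality X → (h : ℕ → X) → Invariant n f h →
  h a ≢ h c → h b ≢ h d → ¬ (h b ≡ h a × h d ≡ h c) → ¬ (h b ≡ h c × h d ≡ h a) →
  suc (suc (z n ((f ∘ₚ tr a c) ∘ₚ tr b d))) ≡ z n f
z-join-join {n} {f} {a} {b} {c} {d} P ra rb rc rd _≟ˣ_ h inv a≁c b≁d ¬ab ¬bc =
  trans (cong suc (z-join (∘ₚ-perm P (tr-perm ra rc)) (κ ∘ h) κ-inv rb rd
                    (collapse-≢ _≟ˣ_ b≁d ¬ab ¬bc)))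
        (z-join P h inv ra rc a≁c)
  where
  κ = collapse _≟ˣ_ (h a) (h c)
  κ-inv : Invariant n (f ∘ₚ tr a c) (κ ∘ h)
  κ-inv {x} rx = trans (cong κ (inv (range (tr-perm ra rc) rx)))
                       (tr-invariant (κ ∘ h) (collapse-≡ _≟ˣ_ (h a) (h c)) x)

-- Colors and the relabelling

module _ (i j k ℓ : ℕ) where

  color-A : ∀ {x} → x ≤ i → color i j k ℓ x ≡ cA
  color-A x≤i rewrite ≤ᵇ-true x≤i = refl

  color-B : ∀ {x} → i < x → x ≤ j → color i j k ℓ x ≡ cB
  color-B i<x x≤j rewrite ≤ᵇ-false i<x | ≤ᵇ-true x≤j = refl

  color-C : i ≤ j → ∀ {x} → j < x → x ≤ k → color i j k ℓ x ≡ cC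
  color-C i≤j j<x x≤k rewrite ≤ᵇ-false (≤-<-trans i≤j j<x) | ≤ᵇ-false j<x | ≤ᵇ-true x≤k = refl

  color-D : i ≤ j → j ≤ k → ∀ {x} → k < x → x ≤ ℓ → color i j k ℓ x ≡ cD
  color-D i≤j j≤k k<x x≤ℓ
    rewrite ≤ᵇ-false (≤-<-trans i≤j (≤-<-trans j≤k k<x)) | ≤ᵇ-false (≤-<-trans j≤k k<x)
          | ≤ᵇ-false k<x | ≤ᵇ-true x≤ℓ = refl

  color-A′ : i ≤ j → j ≤ k → k ≤ ℓ → ∀ {x} → ℓ < x → color i j k ℓ x ≡ cA
  color-A′ i≤j j≤k k≤ℓ ℓ<x
    rewrite ≤ᵇ-false (≤-<-trans i≤j (≤-<-trans j≤k (≤-<-trans k≤ℓ ℓ<x)))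
          | ≤ᵇ-false (≤-<-trans j≤k (≤-<-trans k≤ℓ ℓ<x))
          | ≤ᵇ-false (≤-<-trans k≤ℓ ℓ<x) | ≤ᵇ-false ℓ<x = refl

  φ-A : ∀ {x} → color i j k ℓ x ≡ cA → φ i j k ℓ x ≡ x
  φ-A e rewrite e = refl

  φ-B : ∀ x → color i j k ℓ x ≡ cB → φ i j k ℓ x ≡ x + ℓ ∸ j
  φ-B x e rewrite e = refl

  φ-C : ∀ x → color i j k ℓ x ≡ cC → φ i j k ℓ x ≡ x + i + ℓ ∸ j ∸ k
  φ-C x e rewrite e = refl

  φ-D : ∀ x → color i j k ℓ x ≡ cD → φ i j k ℓ x ≡ x + i ∸ k
  φ-D x e rewrite e = refl

-- φ in terms of i and the lengths b, c, d of B, C, D.  As φ reverses the order of the three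
-- intervals, its inverse is obtained by exchanging b and d.
φ′ : ℕ → ℕ → ℕ → ℕ → ℕ → ℕ
φ′ i b c d = φ i (i + b) (i + b + c) (i + b + c + d)

data Segment (i b c d : ℕ) : ℕ → Set where
  segA : ∀ {x} → x ≤ i → Segment i b c d x
  segB : ∀ s → 1 ≤ s → s ≤ b → Segment i b c d (i + s)
  segC : ∀ s → 1 ≤ s → s ≤ c → Segment i b c d (i + b + s)
  segD : ∀ s → 1 ≤ s → s ≤ d → Segment i b c d (i + b + c + s)
  segZ : ∀ {x} → i + b + c + d < x → Segment i b c d x

offset : ∀ {a b x} → a < x → x ≤ a + b → ∃[ s ] (1 ≤ s × s ≤ b × a + s ≡ x)
offset {a} {b} {x} a<x x≤a+b with m≤n⇒∃[o]m+o≡n a<x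
... | o , refl = suc o , s≤s z≤n , +-cancelˡ-≤ a (suc o) b (subst (_≤ a + b) (sym (+-suc a o)) x≤a+b) , +-suc a o

segment : ∀ i b c d x → Segment i b c d x
segment i b c d x with x ≤? i
... | yes x≤i = segA x≤i
... | no x≰i with x ≤? i + b
...   | yes x≤j with s , 1≤s , s≤b , refl ← offset (≰⇒> x≰i) x≤j = segB s 1≤s s≤b
...   | no x≰j with x ≤? i + b + c
...     | yes x≤k with s , 1≤s , s≤c , refl ← offset (≰⇒> x≰j) x≤k = segC s 1≤s s≤c
...     | no x≰k with x ≤? i + b + c + d
...       | yes x≤ℓ with s , 1≤s , s≤d , refl ← offset (≰⇒> x≰k) x≤ℓ = segD s 1≤s s≤d
...       | no x≰ℓ  = segZ (≰⇒> x≰ℓ)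

-- Keeps truncated subtraction exact: the ring identities below display each minuend as a sum.
cancel : ∀ {x} m {y} → x ≡ m + y → x ∸ m ≡ y
cancel m {y} refl = m+n∸m≡n m y

module _ (i b c d : ℕ) where

  private
    j k ℓ : ℕ
    j = i + b
    k = i + b + c
    ℓ = i + b + c + d

  φ′-A : ∀ {x} → x ≤ i → φ′ i b c d x ≡ x
  φ′-A x≤i = φ-A i j k ℓ (color-A i j k ℓ x≤i)

  φ′-B : ∀ {s} → 1 ≤ s → s ≤ b → φ′ i b c d (i + s) ≡ i + d + c + s
  φ′-B {s} 1≤s s≤b = trans (φ-B i j k ℓ (i + s) (color-B i j k ℓ (m<m+n i 1≤s) (+-monoʳ-≤ i s≤b)))
    (cancel (i + b) (arith i b c d s))
    where
    arith : ∀ i b c d s → i + s + (i + b + c + d) ≡ i + b + (i + d + c + s)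
    arith = solve-∀

  φ′-C : ∀ {s} → 1 ≤ s → s ≤ c → φ′ i b c d (i + b + s) ≡ i + d + s
  φ′-C {s} 1≤s s≤c =
    trans (φ-C i j k ℓ (i + b + s) (color-C i j k ℓ (m≤m+n i b) (m<m+n (i + b) 1≤s) (+-monoʳ-≤ (i + b) s≤c)))
      (cancel (i + b + c) (cancel (i + b) (arith i b c d s)))
    where
    arith : ∀ i b c d s → i + b + s + i + (i + b + c + d) ≡ i + b + (i + b + c + (i + d + s))
    arith = solve-∀

  φ′-D : ∀ {s} → 1 ≤ s → s ≤ d → φ′ i b c d (i + b + c + s) ≡ i + s
  φ′-D {s} 1≤s s≤d =
    trans (φ-D i j k ℓ (i + b + c + s)
            (color-D i j k ℓ (m≤m+n i b) (m≤m+n j c) (m<m+n k 1≤s) (+-monoʳ-≤ k s≤d)))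
      (cancel (i + b + c) (arith i b c s))
    where
    arith : ∀ i b c s → i + b + c + s + i ≡ i + b + c + (i + s)
    arith = solve-∀

  φ′-Z : ∀ {x} → i + b + c + d < x → φ′ i b c d x ≡ x
  φ′-Z ℓ<x = φ-A i j k ℓ (color-A′ i j k ℓ (m≤m+n i b) (m≤m+n (i + b) c) (m≤m+n (i + b + c) d) ℓ<x)

ends-agree : ∀ i b c d → i + b + c + d ≡ i + d + c + b
ends-agree = solve-∀

φ′-inverse : ∀ i b c d x → φ′ i d c b (φ′ i b c d x) ≡ x
φ′-inverse i b c d x with segment i b c d x
... | segA x≤i rewrite φ′-A i b c d x≤i = φ′-A i d c b x≤i
... | segB s 1≤s s≤b rewrite φ′-B i b c d 1≤s s≤b = φ′-D i d c b 1≤s s≤b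
... | segC s 1≤s s≤c rewrite φ′-C i b c d 1≤s s≤c = φ′-C i d c b 1≤s s≤c
... | segD s 1≤s s≤d rewrite φ′-D i b c d 1≤s s≤d = φ′-B i d c b 1≤s s≤d
... | segZ ℓ<x rewrite φ′-Z i b c d ℓ<x = φ′-Z i d c b (subst (_< x) (ends-agree i b c d) ℓ<x)

φ′-range : ∀ {n} i b c d → i + b + c + d ≤ n → ∀ {x} → InRange n x → InRange n (φ′ i b c d x)
φ′-range {n} i b c d ℓ≤n {x} rx@(1≤x , x≤n) with segment i b c d x
... | segA x≤i rewrite φ′-A i b c d x≤i = rx
... | segB s 1≤s s≤b rewrite φ′-B i b c d 1≤s s≤b = ≤-trans 1≤s (m≤n+m s _) ,
  ≤-trans (+-monoʳ-≤ (i + d + c) s≤b) (subst (_≤ n) (ends-agree i b c d) ℓ≤n)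
... | segC s 1≤s s≤c rewrite φ′-C i b c d 1≤s s≤c = ≤-trans 1≤s (m≤n+m s _) ,
  ≤-trans (+-monoʳ-≤ (i + d) s≤c)
    (≤-trans (m≤m+n (i + d + c) b) (subst (_≤ n) (ends-agree i b c d) ℓ≤n))
... | segD s 1≤s s≤d rewrite φ′-D i b c d 1≤s s≤d = ≤-trans 1≤s (m≤n+m s _) ,
  ≤-trans (+-monoʳ-≤ i s≤d) (≤-trans (≤-trans (m≤m+n (i + d) c) (m≤m+n (i + d + c) b))
    (subst (_≤ n) (ends-agree i b c d) ℓ≤n))
... | segZ ℓ<x rewrite φ′-Z i b c d ℓ<x = rx

φ′-perm : ∀ {n} i b c d → i + b + c + d ≤ n → Perm n (φ′ i b c d)
φ′-perm {n} i b c d ℓ≤n = record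
  { inverse       = φ′ i d c b
  ; range         = φ′-range i b c d ℓ≤n
  ; inverse-range = φ′-range i d c b (subst (_≤ n) (ends-agree i b c d) ℓ≤n)
  ; f-inverse     = λ _ → φ′-inverse i d c b _
  ; inverse-f     = λ _ → φ′-inverse i b c d _
  }

-- φ⁻¹ ζ φ runs through A, D, C, B in this order, so it differs from ζ only at the last
-- points i, j, k, ℓ of the intervals.
φ′-ζ : ∀ {n} i b c d → 1 ≤ i → 1 ≤ b → 1 ≤ d → i + b + c + d ≤ n → ∀ {x} → InRange n x →
       φ′ i b c d (ζ n (tr i (i + b + c) (tr (i + b) (i + b + c + d) x))) ≡ ζ n (φ′ i b c d x)
φ′-ζ {n} i b c d 1≤i 1≤b 1≤d ℓ≤n {x} rx = by-segment (segment i b c d x) rx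
  where
  j k ℓ : ℕ
  j = i + b
  k = i + b + c
  ℓ = i + b + c + d
  i<j : i < j
  i<j = m<m+n i 1≤b
  j≤k : j ≤ k
  j≤k = m≤m+n j c
  k<ℓ : k < ℓ
  k<ℓ = m<m+n k 1≤d
  i<k = <-≤-trans i<j j≤k
  j<ℓ = ≤-<-trans j≤k k<ℓ
  i<ℓ = <-trans i<k k<ℓ
  i<n = <-≤-trans i<ℓ ℓ≤n
  end≤n : i + d + c + b ≤ n
  end≤n = subst (_≤ n) (ends-agree i b c d) ℓ≤n
  τ : ℕ → ℕ
  τ x = tr i k (tr j ℓ x)
  Φζ : ℕ → ℕ
  Φζ x = φ′ i b c d (ζ n x)
  τ-fixed : ∀ {x} → x ≢ i → x ≢ j → x ≢ k → x ≢ ℓ → τ x ≡ x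
  τ-fixed x≢i x≢j x≢k x≢ℓ = trans (cong (tr i k) (tr-other x≢j x≢ℓ)) (tr-other x≢i x≢k)
  Φζ-suc : ∀ {x} → x < n → Φζ x ≡ φ′ i b c d (suc x)
  Φζ-suc x<n = cong (φ′ i b c d) (ζ-suc x<n)
  Φζ-ℓ : ∀ {x} → ℓ ≤ x → x ≤ n → Φζ x ≡ ζ n x
  Φζ-ℓ {x} ℓ≤x x≤n with x ≟ n
  ... | yes refl rewrite ζ-last n = φ′-A i b c d 1≤i
  ... | no x≢n rewrite ζ-suc (≤∧≢⇒< x≤n x≢n) = φ′-Z i b c d (s≤s ℓ≤x)
  τi : τ i ≡ k
  τi = trans (cong (tr i k) (tr-other (<⇒≢ i<j) (<⇒≢ i<ℓ))) (tr-left i k)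
  τj : τ j ≡ ℓ
  τj = trans (cong (tr i k) (tr-left j ℓ)) (tr-other (>⇒≢ i<ℓ) (>⇒≢ k<ℓ))
  τk : j ≢ k → τ k ≡ i
  τk j≢k = trans (cong (tr i k) (tr-other (≢-sym j≢k) (<⇒≢ k<ℓ))) (tr-right i k)
  τℓ : τ ℓ ≡ tr i k j
  τℓ = cong (tr i k) (tr-right j ℓ)
  -- Common shape of the steps: x gets the new label m + s, and the point after τ x the label m + s
  -- + 1.
  jump : ∀ x {y} m {s} → τ x ≡ y → y < n → φ′ i b c d (suc y) ≡ m + suc s →
         φ′ i b c d x ≡ m + s → m + s < n → Φζ (τ x) ≡ ζ n (φ′ i b c d x)
  jump x m {s} τx y<n e e′ m+s<n = trans (cong Φζ τx) (trans (Φζ-suc y<n)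
    (trans e (trans (+-suc m s) (trans (sym (ζ-suc m+s<n)) (cong (ζ n) (sym e′))))))
  by-segment : ∀ {x} → Segment i b c d x → InRange n x → Φζ (τ x) ≡ ζ n (φ′ i b c d x)
  by-segment {x} (segA x≤i) rx with x ≟ i
  ... | yes refl = jump x i τi (<-≤-trans k<ℓ ℓ≤n)
    (trans (cong (φ′ i b c d) (sym (+-comm k 1))) (φ′-D i b c d ≤-refl 1≤d))
    (trans (φ′-A i b c d ≤-refl) (sym (+-identityʳ i))) (subst (_< n) (sym (+-identityʳ i)) i<n)
  ... | no x≢i = jump x 0
    (τ-fixed x≢i (<⇒≢ (≤-<-trans x≤i i<j)) (<⇒≢ (≤-<-trans x≤i i<k)) (<⇒≢ (≤-<-trans x≤i i<ℓ)))
    (≤-<-trans x≤i i<n) (φ′-A i b c d (≤∧≢⇒< x≤i x≢i)) (φ′-A i b c d x≤i) (≤-<-trans x≤i i<n)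
  by-segment (segB s 1≤s s≤b) rx with s ≟ b
  ... | yes refl = trans (cong Φζ τj) (trans (Φζ-ℓ ≤-refl ℓ≤n)
    (cong (ζ n) (trans (ends-agree i b c d) (sym (φ′-B i b c d 1≤b ≤-refl)))))
  ... | no s≢b = jump (i + s) (i + d + c)
    (τ-fixed (>⇒≢ (m<m+n i 1≤s)) (<⇒≢ x<j) (<⇒≢ (<-≤-trans x<j j≤k)) (<⇒≢ (<-trans x<j j<ℓ)))
    (<-≤-trans (<-trans x<j j<ℓ) ℓ≤n)
    (trans (cong (φ′ i b c d) (sym (+-suc i s))) (φ′-B i b c d (s≤s z≤n) s<b))
    (φ′-B i b c d 1≤s s≤b) (<-≤-trans (+-monoʳ-< (i + d + c) s<b) end≤n)
    where
    s<b = ≤∧≢⇒< s≤b s≢b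
    x<j = +-monoʳ-< i s<b
  by-segment (segC s 1≤s s≤c) rx with s ≟ c
  ... | yes refl = jump (j + s) (i + d + c) {0} (τk (<⇒≢ (m<m+n j 1≤s))) i<n
    (trans (cong (φ′ i b c d) (sym (+-comm i 1))) (φ′-B i b c d ≤-refl 1≤b))
    (trans (φ′-C i b c d 1≤s ≤-refl) (sym (+-identityʳ (i + d + c))))
    (<-≤-trans (+-monoʳ-< (i + d + c) 1≤b) end≤n)
  ... | no s≢c = jump (j + s) (i + d)
    (τ-fixed (>⇒≢ (<-trans i<j (m<m+n j 1≤s))) (>⇒≢ (m<m+n j 1≤s)) (<⇒≢ x<k) (<⇒≢ (<-trans x<k k<ℓ)))
    (<-≤-trans (<-trans x<k k<ℓ) ℓ≤n)
    (trans (cong (φ′ i b c d) (sym (+-suc j s))) (φ′-C i b c d (s≤s z≤n) s<c))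
    (φ′-C i b c d 1≤s s≤c)
    (<-≤-trans (+-monoʳ-< (i + d) s<c) (≤-trans (m≤m+n (i + d + c) b) end≤n))
    where
    s<c = ≤∧≢⇒< s≤c s≢c
    x<k = +-monoʳ-< j s<c
  by-segment (segD s 1≤s s≤d) rx with s ≟ d
  ... | no s≢d = jump (k + s) i
    (τ-fixed (>⇒≢ (<-trans i<k k<x)) (>⇒≢ (≤-<-trans j≤k k<x)) (>⇒≢ k<x) (<⇒≢ x<ℓ))
    (<-≤-trans x<ℓ ℓ≤n)
    (trans (cong (φ′ i b c d) (sym (+-suc k s))) (φ′-D i b c d (s≤s z≤n) s<d))
    (φ′-D i b c d 1≤s s≤d)
    (<-≤-trans (+-monoʳ-< i s<d) (≤-trans (m≤m+n (i + d) c) (≤-trans (m≤m+n (i + d + c) b) end≤n)))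
    where
    s<d = ≤∧≢⇒< s≤d s≢d
    k<x = m<m+n k 1≤s
    x<ℓ = +-monoʳ-< k s<d
  ... | yes refl with j ≟ k
  -- C is empty: D is followed directly by B, and indeed τ sends ℓ through j = k to i.
  ...   | yes j≡k = jump (k + s) (i + d) {0}
    (trans τℓ (trans (cong (tr i k) j≡k) (tr-right i k))) i<n
    (trans (cong (φ′ i b c d) (sym (+-comm i 1))) (trans (φ′-B i b c d ≤-refl 1≤b)
      (trans (cong (λ c → i + d + c + 1) c≡0) (cong (_+ 1) (+-identityʳ (i + d))))))
    (trans (φ′-D i b c d 1≤s ≤-refl) (sym (+-identityʳ (i + d))))
    bound
    where
    c≡0 : c ≡ 0
    c≡0 = +-cancelˡ-≡ j c 0 (trans (sym j≡k) (sym (+-identityʳ j)))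
    bound : i + d + 0 < n
    bound = <-≤-trans (+-monoʳ-< (i + d) 1≤b)
      (≤-trans (+-monoˡ-≤ b (m≤m+n (i + d) c)) end≤n)
  ...   | no j≢k = jump (k + s) (i + d) {0}
    (trans τℓ (tr-other (>⇒≢ i<j) j≢k)) (<-≤-trans j<ℓ ℓ≤n)
    (trans (cong (φ′ i b c d) (sym (+-comm j 1))) (φ′-C i b c d ≤-refl 1≤c))
    (trans (φ′-D i b c d 1≤s ≤-refl) (sym (+-identityʳ (i + d))))
    (<-≤-trans (+-monoʳ-< (i + d) 1≤c) (≤-trans (m≤m+n (i + d + c) b) end≤n))
    where
    1≤c : 1 ≤ c
    1≤c = n≢0⇒n>0 λ c≡0 → j≢k (trans (sym (+-identityʳ j)) (cong (j +_) (sym c≡0)))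
  by-segment {x} (segZ ℓ<x) (_ , x≤n) =
    trans (cong Φζ (τ-fixed (>⇒≢ (<-trans i<ℓ ℓ<x)) (>⇒≢ (<-trans j<ℓ ℓ<x)) (>⇒≢ (<-trans k<ℓ ℓ<x)) (>⇒≢ ℓ<x)))
      (trans (Φζ-ℓ (<⇒≤ ℓ<x) x≤n) (cong (ζ n) (sym (φ′-Z i b c d ℓ<x))))

-- Blocks joining colors

code : Color → ℕ
code cA = 0
code cB = 1
code cC = 2
code cD = 3

code-injective : ∀ {X Y} → code X ≡ code Y → X ≡ Y
code-injective {cA} {cA} _ = refl
code-injective {cB} {cB} _ = refl
code-injective {cC} {cC} _ = refl
code-injective {cD} {cD} _ = refl

_≟ᶜ_ : DecidableEquality Color
X ≟ᶜ Y = map′ code-injective (cong code) (code X ≟ code Y)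

allColor? : {P : Color → Set} → (∀ X → Dec (P X)) → Dec (∀ X → P X)
allColor? P? = map′
  (λ { (a , b , c , d) cA → a ; (a , b , c , d) cB → b ; (a , b , c , d) cC → c ; (a , b , c , d) cD → d })
  (λ p → p cA , p cB , p cC , p cD)
  (P? cA ×-dec P? cB ×-dec P? cC ×-dec P? cD)

anyColor? : {P : Color → Set} → (∀ X → Dec (P X)) → Dec (∃ P)
anyColor? P? with P? cA | P? cB | P? cC | P? cD
... | yes p | _     | _     | _     = yes (cA , p)
... | _     | yes p | _     | _     = yes (cB , p)
... | _     | _     | yes p | _     = yes (cC , p)
... | _     | _     | _     | yes p = yes (cD , p)
... | no ¬a | no ¬b | no ¬c | no ¬d =
  no λ { (cA , p) → ¬a p ; (cB , p) → ¬b p ; (cC , p) → ¬c p ; (cD , p) → ¬d p }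

anyInRange? : ∀ n {P : ℕ → Set} → (∀ x → Dec (P x)) → Dec (∃[ x ] (InRange n x × P x))
anyInRange? n P? = map′
  (λ (x , x≤n , 1≤x , p) → x , (1≤x , ≤-pred x≤n) , p)
  (λ (x , (1≤x , x≤n) , p) → x , s≤s x≤n , 1≤x , p)
  (anyUpTo? (λ x → (1 ≤? x) ×-dec P? x) (suc n))

Distinct : Color → Color → Color → Set
Distinct X Y Z = X ≢ Y × X ≢ Z × Y ≢ Z

distinct? : ∀ X Y Z → Dec (Distinct X Y Z)
distinct? X Y Z = ¬? (X ≟ᶜ Y) ×-dec ¬? (X ≟ᶜ Z) ×-dec ¬? (Y ≟ᶜ Z)

isB isC isD isBC isCD isBCD : Color → Bool
isB cB = true
isB _  = false
isC cC = true
isC _  = false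
isD cD = true
isD _  = false
isBC X = isB X ∨ isC X
isCD X = isC X ∨ isD X
isBCD X = isB X ∨ isCD X

Constant : (Color → Bool) → Color → Color → Color → Set
Constant s X Y Z = s X ≡ s Y × s X ≡ s Z

constant? : ∀ s X Y Z → Dec (Constant s X Y Z)
constant? s X Y Z = (s X Bool.≟ s Y) ×-dec (s X Bool.≟ s Z)

-- Three distinct colors fit neither into {B,C} nor into {A,D}. Here and below the check runs
-- through all triples of colors.
distinct-BC : ∀ X Y Z → Distinct X Y Z → ¬ Constant isBC X Y Z
distinct-BC = from-yes (allColor? λ X → allColor? λ Y → allColor? λ Z →
  distinct? X Y Z →-dec ¬? (constant? isBC X Y Z))

distinct-CD : ∀ X Y Z → Distinct X Y Z → ¬ Constant isCD X Y Z
distinct-CD = from-yes (allColor? λ X → allColor? λ Y → allColor? λ Z →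
  distinct? X Y Z →-dec ¬? (constant? isCD X Y Z))

-- Distinct colors are not all B, so constancy excludes B, and likewise D; only A and C would
-- remain.
distinct-B-D : ∀ X Y Z → Distinct X Y Z → ¬ (Constant isB X Y Z × Constant isD X Y Z)
distinct-B-D = from-yes (allColor? λ X → allColor? λ Y → allColor? λ Z →
  distinct? X Y Z →-dec ¬? (constant? isB X Y Z ×-dec constant? isD X Y Z))

-- In the same way C and A are excluded, and only B and D would remain.
distinct-C-BCD : ∀ X Y Z → Distinct X Y Z → ¬ (Constant isC X Y Z × Constant isBCD X Y Z)
distinct-C-BCD = from-yes (allColor? λ X → allColor? λ Y → allColor? λ Z →
  distinct? X Y Z →-dec ¬? (constant? isC X Y Z ×-dec constant? isBCD X Y Z))

-- The color of x together with the truth values of i < x, j < x, k < x, ℓ < x.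
data Row : Color → Bool → Bool → Bool → Bool → Set where
  rowA : Row cA false false false false
  rowB : Row cB true  false false false
  rowC : Row cC true  true  false false
  rowD : Row cD true  true  true  false
  rowZ : Row cA true  true  true  true

module FourColoring (n : ℕ) (lab : ℕ → ℕ) (nc : NonCrossing n lab) (i j k ℓ : ℕ)
  (1≤i : 1 ≤ i) (i<j : i < j) (j≤k : j ≤ k) (k<ℓ : k < ℓ) (ℓ≤n : ℓ ≤ n) where

  private
    i<k = <-≤-trans i<j j≤k
    j<ℓ = ≤-<-trans j≤k k<ℓ
    i<ℓ = <-trans i<k k<ℓ
    1≤j = ≤-trans 1≤i (<⇒≤ i<j)
    1≤k = ≤-trans 1≤i (<⇒≤ i<k)
    ri : InRange n i
    ri = 1≤i , <⇒≤ (<-≤-trans i<ℓ ℓ≤n)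
    rj : InRange n j
    rj = 1≤j , <⇒≤ (<-≤-trans j<ℓ ℓ≤n)
    rk : InRange n k
    rk = 1≤k , <⇒≤ (<-≤-trans k<ℓ ℓ≤n)
    rℓ : InRange n ℓ
    rℓ = ≤-trans 1≤i (<⇒≤ i<ℓ) , ℓ≤n

    col : ℕ → Color
    col = color i j k ℓ

    K : ℕ → ℕ
    K = Kreweras n lab

    PK : Perm n K
    PK = Kreweras-perm n lab

    row : ∀ x → Row (col x) (i <ᵇ x) (j <ᵇ x) (k <ᵇ x) (ℓ <ᵇ x)
    row x with x ≤? i
    ... | yes x≤i rewrite color-A i j k ℓ x≤i | <ᵇ-false x≤i | <ᵇ-false (≤-trans x≤i (<⇒≤ i<j))
                        | <ᵇ-false (≤-trans x≤i (<⇒≤ i<k)) | <ᵇ-false (≤-trans x≤i (<⇒≤ i<ℓ)) = rowA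
    ... | no x≰i with x ≤? j
    ...   | yes x≤j rewrite color-B i j k ℓ (≰⇒> x≰i) x≤j | <ᵇ-true (≰⇒> x≰i) | <ᵇ-false x≤j
                          | <ᵇ-false (≤-trans x≤j j≤k) | <ᵇ-false (≤-trans x≤j (<⇒≤ j<ℓ)) = rowB
    ...   | no x≰j with x ≤? k
    ...     | yes x≤k rewrite color-C i j k ℓ (<⇒≤ i<j) (≰⇒> x≰j) x≤k | <ᵇ-true (≰⇒> x≰i)
                            | <ᵇ-true (≰⇒> x≰j) | <ᵇ-false x≤k
                            | <ᵇ-false (≤-trans x≤k (<⇒≤ k<ℓ)) = rowC
    ...     | no x≰k with x ≤? ℓ
    ...       | yes x≤ℓ rewrite color-D i j k ℓ (<⇒≤ i<j) j≤k (≰⇒> x≰k) x≤ℓ | <ᵇ-true (≰⇒> x≰i)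
                              | <ᵇ-true (≰⇒> x≰j) | <ᵇ-true (≰⇒> x≰k) | <ᵇ-false x≤ℓ = rowD
    ...       | no x≰ℓ  rewrite color-A′ i j k ℓ (<⇒≤ i<j) j≤k (<⇒≤ k<ℓ) (≰⇒> x≰ℓ)
                              | <ᵇ-true (≰⇒> x≰i) | <ᵇ-true (≰⇒> x≰j) | <ᵇ-true (≰⇒> x≰k)
                              | <ᵇ-true (≰⇒> x≰ℓ) = rowZ

    Colored : ℕ → ℕ → (Color → Bool) → Set
    Colored u v s = ∀ x → inside u v x ≡ s (col x)

    tabulated : ∀ (t : Bool → Bool → Bool → Bool → Bool) (s : Color → Bool) →
      t false false false false ≡ s cA → t true false false false ≡ s cB →
      t true true false false ≡ s cC → t true true true false ≡ s cD →
      t true true true true ≡ s cA → ∀ x → t (i <ᵇ x) (j <ᵇ x) (k <ᵇ x) (ℓ <ᵇ x) ≡ s (col x)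
    tabulated t s a b c d a′ x with col x | i <ᵇ x | j <ᵇ x | k <ᵇ x | ℓ <ᵇ x | row x
    ... | _ | _ | _ | _ | _ | rowA = a
    ... | _ | _ | _ | _ | _ | rowB = b
    ... | _ | _ | _ | _ | _ | rowC = c
    ... | _ | _ | _ | _ | _ | rowD = d
    ... | _ | _ | _ | _ | _ | rowZ = a′

    inside-ij : Colored i j isB
    inside-ij = tabulated (λ i j k ℓ → i ∧ not j) isB refl refl refl refl refl

    inside-ik : Colored i k isBC
    inside-ik = tabulated (λ i j k ℓ → i ∧ not k) isBC refl refl refl refl refl

    inside-iℓ : Colored i ℓ isBCD
    inside-iℓ = tabulated (λ i j k ℓ → i ∧ not ℓ) isBCD refl refl refl refl refl

    inside-jk : Colored j k isC
    inside-jk = tabulated (λ i j k ℓ → j ∧ not k) isC refl refl refl refl refl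

    inside-jℓ : Colored j ℓ isCD
    inside-jℓ = tabulated (λ i j k ℓ → j ∧ not ℓ) isCD refl refl refl refl refl

    inside-kℓ : Colored k ℓ isD
    inside-kℓ = tabulated (λ i j k ℓ → k ∧ not ℓ) isD refl refl refl refl refl

  -- The graph on the four colors

  MeetsColor : ℕ → Color → Set
  MeetsColor = Meets n lab i j k ℓ

  Edge : Color → Color → Set
  Edge X Y = ∃[ a ] (InRange n a × col a ≡ X × MeetsColor a Y)

  edge? : ∀ X Y → Dec (Edge X Y)
  edge? X Y = anyInRange? n λ a → (col a ≟ᶜ X) ×-dec
    anyInRange? n λ y → (lab y ≟ lab a) ×-dec (col y ≟ᶜ Y)

  edge-sym : ∀ {X Y} → Edge X Y → Edge Y X
  edge-sym (a , ra , ca , b , rb , l , cb) = b , rb , cb , a , ra , sym l , ca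

  meets-edge : ∀ {a X Y} → MeetsColor a X → MeetsColor a Y → Edge X Y
  meets-edge (x , rx , lx , cx) (y , ry , ly , cy) = x , rx , cx , y , ry , trans ly (sym lx) , cy

  -- A color with two neighbors. Forgetting which blocks carry the edges unites the two conditions
  -- of the theorem.
  Corner : Set
  Corner = ∃[ X ] ∃[ Y ] ∃[ Z ] (Distinct X Y Z × Edge X Y × Edge X Z)

  corner? : Dec Corner
  corner? = anyColor? λ X → anyColor? λ Y → anyColor? λ Z →
    distinct? X Y Z ×-dec edge? X Y ×-dec edge? X Z

  Cond : Set
  Cond = Cond1 n lab i j k ℓ ⊎ Cond2 n lab i j k ℓ

  cond⇒corner : Cond → Corner
  cond⇒corner (inj₁ (a , X , Y , Z , _ , X≢Y , X≢Z , Y≢Z , mX , mY , mZ)) =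
    X , Y , Z , (X≢Y , X≢Z , Y≢Z) , meets-edge mX mY , meets-edge mX mZ
  cond⇒corner (inj₂ (a , b , X , Y , Z , _ , _ , _ , X≢Y , X≢Z , Y≢Z , aX , aY , _ , bX , bZ , _)) =
    X , Y , Z , (X≢Y , X≢Z , Y≢Z) , meets-edge aX aY , meets-edge bX bZ

  subset-or-third : ∀ a X Y → SubsetOf n lab i j k ℓ a X Y ⊎
    (∃[ w ] (InRange n w × lab w ≡ lab a × col w ≢ X × col w ≢ Y))
  subset-or-third a X Y
    with anyInRange? n (λ w → (lab w ≟ lab a) ×-dec ¬? (col w ≟ᶜ X) ×-dec ¬? (col w ≟ᶜ Y))
  ... | yes third = inj₂ third
  ... | no none   = inj₁ subset
    where
    subset : SubsetOf n lab i j k ℓ a X Y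
    subset x rx lx with col x ≟ᶜ X | col x ≟ᶜ Y
    ... | yes cx | _      = inj₁ cx
    ... | no _   | yes cx = inj₂ cx
    ... | no x≢X | no x≢Y = contradiction (x , rx , lx , x≢X , x≢Y) none

  -- A single block carrying both edges meets three colors, and so does a block with a color beyond
  -- its edge. Otherwise the two blocks are as in the second condition.
  corner⇒cond : Corner → Cond
  corner⇒cond (X , Y , Z , (X≢Y , X≢Z , Y≢Z) , (a , ra , ca , aY) , (b , rb , cb , bZ@(w , rw , lw , cw)))
    with lab a ≟ lab b
  ... | yes la≡lb = inj₁ (a , X , Y , Z , ra , X≢Y , X≢Z , Y≢Z ,
    (a , ra , refl , ca) , aY , (w , rw , trans lw (sym la≡lb) , cw))
  ... | no la≢lb with subset-or-third a X Y | subset-or-third b X Z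
  ...   | inj₂ (t , rt , lt , t≢X , t≢Y) | _ = inj₁ (a , X , Y , col t , ra , X≢Y , ≢-sym t≢X , ≢-sym t≢Y ,
    (a , ra , refl , ca) , aY , (t , rt , lt , refl))
  ...   | inj₁ _ | inj₂ (t , rt , lt , t≢X , t≢Z) = inj₁ (b , X , Z , col t , rb , X≢Z , ≢-sym t≢X , ≢-sym t≢Z ,
    (b , rb , refl , cb) , bZ , (t , rt , lt , refl))
  ...   | inj₁ a⊆ | inj₁ b⊆ = inj₂ (a , b , X , Y , Z , ra , rb , la≢lb , X≢Y , X≢Z , Y≢Z ,
    (a , ra , refl , ca) , aY , a⊆ , (b , rb , refl , cb) , bZ , b⊆)

  τ-perm : Perm n (tr i k ∘ₚ tr j ℓ)
  τ-perm = ∘ₚ-perm (tr-perm ri rk) (tr-perm rj rℓ)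

  Kτ : ℕ → ℕ
  Kτ = (K ∘ₚ tr i k) ∘ₚ tr j ℓ

  Kτ-perm : Perm n Kτ
  Kτ-perm = ∘ₚ-perm (∘ₚ-perm PK (tr-perm ri rk)) (tr-perm rj rℓ)

  -- If the arcs of both edge-carrying blocks agree at u and v, then (u,v] cuts neither block and
  -- hence neither edge. Every coincidence that `z-join-join` forbids would thus confine X, Y, Z to
  -- two colors.
  z-corner : Corner → suc (suc (z n Kτ)) ≡ z n K
  z-corner (X , Y , Z , dis , (a , ra , ca , y , ry , ly , cy) , (b , rb , cb , w , rw , lw , cw)) =
    z-join-join PK ri rj rk rℓ (≡-dec _≟_ _≟_) h h-invariant
      (λ e → distinct-BC X Y Z dis (constant isBC inside-ik (<⇒≤ i<k) (proj₂ rk) e))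
      (λ e → distinct-CD X Y Z dis (constant isCD inside-jℓ (<⇒≤ j<ℓ) ℓ≤n e))
      (λ (e , e′) → distinct-B-D X Y Z dis
        (constant isB inside-ij (<⇒≤ i<j) (proj₂ rj) (sym e) ,
         constant isD inside-kℓ (<⇒≤ k<ℓ) ℓ≤n (sym e′)))
      (λ (e , e′) → distinct-C-BCD X Y Z dis
        (constant isC inside-jk j≤k (proj₂ rk) e , constant isBCD inside-iℓ (<⇒≤ i<ℓ) ℓ≤n (sym e′)))
    where
    h : ℕ → ℕ × ℕ
    h x = arc n lab (lab a) x , arc n lab (lab b) x
    h-invariant : Invariant n K h
    h-invariant rx = cong₂ _,_ (arc-invariant nc (lab a) rx) (arc-invariant nc (lab b) rx)
    constant : ∀ {u v} s → Colored u v s → u ≤ v → v ≤ n → h u ≡ h v → Constant s X Y Z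
    constant s ins u≤v v≤n e =
      subst₂ (λ X Y → s X ≡ s Y) ca cy (trans (sym (ins a)) (trans
        (arc-separates lab (lab a) u≤v v≤n (cong proj₁ e) ra ry refl ly) (ins y))) ,
      subst₂ (λ X Y → s X ≡ s Y) cb cw (trans (sym (ins b)) (trans
        (arc-separates lab (lab b) u≤v v≤n (cong proj₂ e) rb rw refl lw) (ins w)))

  Separable : Set
  Separable = NotSeparated n lab i k ⊎ NotSeparated n lab j ℓ ⊎
              (NotSeparated n lab i j × NotSeparated n lab k ℓ) ⊎
              (NotSeparated n lab j k × NotSeparated n lab i ℓ)

  not-separated : ∀ {u v} s → Colored u v s →
                  (∀ X Y → s X ≡ true → s Y ≡ false → ¬ Edge X Y) → NotSeparated n lab u v
  not-separated {u} {v} s ins none {x} {y} rx ry l with s (col x) in sx | s (col y) in sy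
  ... | true  | true  = trans (trans (ins x) sx) (sym (trans (ins y) sy))
  ... | false | false = trans (trans (ins x) sx) (sym (trans (ins y) sy))
  ... | true  | false = contradiction (x , rx , refl , y , ry , sym l , refl) (none (col x) (col y) sx sy)
  ... | false | true  = contradiction (y , ry , refl , x , rx , l , refl) (none (col y) (col x) sy sx)

  -- The edges form a matching. AB and CD leave (j,ℓ] uncut, AD and BC leave (i,k] uncut; AC
  -- isolates B and D, and BD isolates A and C.
  no-corner⇒separable : ¬ Corner → Separable
  no-corner⇒separable ¬corner = by-edges (edge? cA cB) (edge? cA cC) (edge? cA cD) (edge? cB cC) (edge? cB cD)
    where
    excl : ∀ {X Y Z} → X ≢ Y → X ≢ Z → Y ≢ Z → Edge X Y → ¬ Edge X Z
    excl X≢Y X≢Z Y≢Z e e′ = ¬corner (_ , _ , _ , (X≢Y , X≢Z , Y≢Z) , e , e′)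
    flip : ∀ {X Y} → ¬ Edge X Y → ¬ Edge Y X
    flip ¬e = ¬e ∘ edge-sym

    ns-ik : ¬ Edge cA cB → ¬ Edge cA cC → ¬ Edge cB cD → ¬ Edge cC cD → NotSeparated n lab i k
    ns-ik ab ac bd cd = not-separated isBC inside-ik λ
      { cB cA _ _ → flip ab ; cB cD _ _ → bd ; cC cA _ _ → flip ac ; cC cD _ _ → cd }
    ns-jℓ : ¬ Edge cA cC → ¬ Edge cB cC → ¬ Edge cA cD → ¬ Edge cB cD → NotSeparated n lab j ℓ
    ns-jℓ ac bc ad bd = not-separated isCD inside-jℓ λ
      { cC cA _ _ → flip ac ; cC cB _ _ → flip bc ; cD cA _ _ → flip ad ; cD cB _ _ → flip bd }
    ns-ij : ¬ Edge cA cB → ¬ Edge cB cC → ¬ Edge cB cD → NotSeparated n lab i j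
    ns-ij ab bc bd = not-separated isB inside-ij λ
      { cB cA _ _ → flip ab ; cB cC _ _ → bc ; cB cD _ _ → bd }
    ns-kℓ : ¬ Edge cA cD → ¬ Edge cB cD → ¬ Edge cC cD → NotSeparated n lab k ℓ
    ns-kℓ ad bd cd = not-separated isD inside-kℓ λ
      { cD cA _ _ → flip ad ; cD cB _ _ → flip bd ; cD cC _ _ → flip cd }
    ns-jk : ¬ Edge cA cC → ¬ Edge cB cC → ¬ Edge cC cD → NotSeparated n lab j k
    ns-jk ac bc cd = not-separated isC inside-jk λ
      { cC cA _ _ → flip ac ; cC cB _ _ → flip bc ; cC cD _ _ → cd }
    ns-iℓ : ¬ Edge cA cB → ¬ Edge cA cC → ¬ Edge cA cD → NotSeparated n lab i ℓ
    ns-iℓ ab ac ad = not-separated isBCD inside-iℓ λ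
      { cB cA _ _ → flip ab ; cC cA _ _ → flip ac ; cD cA _ _ → flip ad }

    located : ∀ {u v X} s → Colored u v s → ∀ x → col x ≡ X → s X ≡ true → u < x × x ≤ v
    located {u} {v} s ins x cx sX = inside-true⁻ {u} {v} (trans (ins x) (trans (cong s cx) sX))
    -- The four points alternate between the two blocks, so noncrossing merges these and creates an
    -- edge AB or BC. As A wraps around, its point may come first or last.
    crossing : ¬ Edge cA cB → ¬ Edge cB cC → Edge cA cC → ¬ Edge cB cD
    crossing ¬ab ¬bc (a , ra , ca , c , rc , lc , cc) (b , rb , cb , d , rd , ld , cd) with a ≤? i
    ... | yes a≤i = ¬ab (a , ra , ca , b , rb ,
      sym (nc a b c d (proj₁ ra) (≤-<-trans a≤i i<b) b<c c<d (proj₂ rd) (sym lc) (sym ld)) , cb)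
      where
      i<b = proj₁ (located isB inside-ij b cb refl)
      b<c = ≤-<-trans (proj₂ (located isB inside-ij b cb refl)) (proj₁ (located isC inside-jk c cc refl))
      c<d = ≤-<-trans (proj₂ (located isC inside-jk c cc refl)) (proj₁ (located isD inside-kℓ d cd refl))
    ... | no a≰i = ¬bc (b , rb , cb , c , rc ,
      sym (nc b c d a (proj₁ rb) b<c c<d d<a (proj₂ ra) (sym ld) lc) , cc)
      where
      b<c = ≤-<-trans (proj₂ (located isB inside-ij b cb refl)) (proj₁ (located isC inside-jk c cc refl))
      c<d = ≤-<-trans (proj₂ (located isC inside-jk c cc refl)) (proj₁ (located isD inside-kℓ d cd refl))
      ℓ<a = ≰⇒> λ a≤ℓ → true≢false
        (trans (sym (inside-true i ℓ (≰⇒> a≰i) a≤ℓ)) (trans (inside-iℓ a) (cong isBCD ca)))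
      d<a = ≤-<-trans (proj₂ (located isD inside-kℓ d cd refl)) ℓ<a

    by-edges : Dec (Edge cA cB) → Dec (Edge cA cC) → Dec (Edge cA cD) →
               Dec (Edge cB cC) → Dec (Edge cB cD) → Separable
    by-edges (yes ab) _ _ _ _ = inj₂ (inj₁ (ns-jℓ
      (excl (λ ()) (λ ()) (λ ()) ab) (excl (λ ()) (λ ()) (λ ()) (edge-sym ab))
      (excl (λ ()) (λ ()) (λ ()) ab) (excl (λ ()) (λ ()) (λ ()) (edge-sym ab))))
    by-edges (no ¬ab) (yes ac) _ _ _ = inj₂ (inj₂ (inj₁ (ns-ij ¬ab ¬bc ¬bd , ns-kℓ ¬ad ¬bd ¬cd)))
      where
      ¬ad = excl (λ ()) (λ ()) (λ ()) ac
      ¬bc = flip (excl (λ ()) (λ ()) (λ ()) (edge-sym ac))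
      ¬cd = excl (λ ()) (λ ()) (λ ()) (edge-sym ac)
      ¬bd = crossing ¬ab ¬bc ac
    by-edges (no ¬ab) (no ¬ac) (yes ad) _ _ = inj₁ (ns-ik ¬ab ¬ac
      (flip (excl (λ ()) (λ ()) (λ ()) (edge-sym ad))) (flip (excl (λ ()) (λ ()) (λ ()) (edge-sym ad))))
    by-edges (no ¬ab) (no ¬ac) (no ¬ad) (yes bc) _ = inj₁ (ns-ik ¬ab ¬ac
      (excl (λ ()) (λ ()) (λ ()) bc) (excl (λ ()) (λ ()) (λ ()) (edge-sym bc)))
    by-edges (no ¬ab) (no ¬ac) (no ¬ad) (no ¬bc) (yes bd) =
      inj₂ (inj₂ (inj₂ (ns-jk ¬ac ¬bc (flip (excl (λ ()) (λ ()) (λ ()) (edge-sym bd))) , ns-iℓ ¬ab ¬ac ¬ad)))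
    by-edges (no ¬ab) (no ¬ac) (no ¬ad) (no ¬bc) (no ¬bd) = inj₂ (inj₁ (ns-jℓ ¬ac ¬bc ¬ad ¬bd))

  -- Cycle counts from unions of blocks

  private
    T≢F : ∀ u v {x} y → u < x → x ≤ v → inside u v y ≡ false → inside u v x ≢ inside u v y
    T≢F u v y u<x x≤v out e = true≢false (trans (sym (inside-true u v u<x x≤v)) (trans e out))

    agree : ∀ {b c : Bool} → b ≡ false → c ≡ false → b ≡ c
    agree p q = trans p (sym q)

    -- Commuting transpositions allow the cyclic shift of i, j, k, ℓ to j, k, ℓ, i, which carries
    -- two of the four cases of `Separable` to the other two.
    rotated : j ≢ k → z n ((K ∘ₚ tr j ℓ) ∘ₚ tr k i) ≡ z n Kτ
    rotated j≢k = z-cong (∘ₚ-perm (∘ₚ-perm PK (tr-perm rj rℓ)) (tr-perm rk ri)) λ {x} _ → cong K (begin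
      tr j ℓ (tr k i x) ≡⟨ cong (tr j ℓ) (tr-sym k i x) ⟩
      tr j ℓ (tr i k x) ≡⟨ tr-commute (<⇒≢ i<j) (<⇒≢ i<ℓ) (≢-sym j≢k) (<⇒≢ k<ℓ) x ⟩
      tr i k (tr j ℓ x) ∎)
      where open ≡-Reasoning

  separable⇒z : Separable → z n Kτ ≡ z n K
  separable⇒z (inj₁ ik) = z-split-join PK ri rj rk rℓ (inside i k)
    (inside-invariant 1≤i i<k (proj₂ rk) ik)
    (≢-sym (T≢F i k i i<k ≤-refl (inside-left i k ≤-refl)))
    (T≢F i k ℓ i<j j≤k (inside-right i k k<ℓ))
  separable⇒z (inj₂ (inj₁ jℓ)) with j ≟ k
  ... | no j≢k = trans (sym (rotated j≢k)) (z-split-join PK rj rk rℓ ri (inside j ℓ)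
    (inside-invariant 1≤j j<ℓ ℓ≤n jℓ)
    (≢-sym (T≢F j ℓ j j<ℓ ≤-refl (inside-left j ℓ ≤-refl)))
    (T≢F j ℓ i (≤∧≢⇒< j≤k j≢k) (<⇒≤ k<ℓ) (inside-left j ℓ (<⇒≤ i<j))))
  -- The 3-cycle is (j ℓ)(ℓ i): the first factor splits off (j,ℓ], which contains ℓ but not i, so
  -- the second joins.
  ... | yes refl = trans
    (z-cong Kτ-perm λ {x} _ → cong K (tr-rotate (<⇒≢ i<j) (<⇒≢ i<ℓ) x))
    (z-split-join PK rj rℓ rℓ ri (inside j ℓ)
      (inside-invariant 1≤j j<ℓ ℓ≤n jℓ)
      (≢-sym (T≢F j ℓ j j<ℓ ≤-refl (inside-left j ℓ ≤-refl)))
      (T≢F j ℓ i j<ℓ ≤-refl (inside-left j ℓ (<⇒≤ i<j))))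
  separable⇒z (inj₂ (inj₂ (inj₁ (ij , kℓ)))) with j ≟ k
  ... | yes refl = separable⇒z (inj₁ ij)
  ... | no j≢k = z-split-split-join-join PK ri rj rk rℓ (inside i j) (inside k ℓ)
    (inside-invariant 1≤i i<j (proj₂ rj) ij)
    (inside-invariant 1≤k k<ℓ ℓ≤n kℓ)
    (agree (inside-left i j ≤-refl) (inside-right i j j<k))
    (agree (inside-right i j j<ℓ) (inside-right i j j<k))
    (T≢F i j k i<j ≤-refl (inside-right i j j<k))
    (agree (inside-left k ℓ (<⇒≤ i<k)) (inside-left k ℓ ≤-refl))
    (agree (inside-left k ℓ j≤k) (inside-left k ℓ ≤-refl))
    (≢-sym (T≢F k ℓ k k<ℓ ≤-refl (inside-left k ℓ ≤-refl)))
    (<⇒≢ i<k)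
    where j<k = ≤∧≢⇒< j≤k j≢k
  separable⇒z (inj₂ (inj₂ (inj₂ (jk , iℓ)))) with j ≟ k
  -- Rotated twice, the 3-cycle is (i ℓ)(i j), whose first factor is the one that splits off (i,ℓ].
  ... | yes refl = trans
    (z-cong Kτ-perm λ {x} _ → cong K (begin
      tr i j (tr j ℓ x) ≡⟨ tr-rotate (<⇒≢ i<j) (<⇒≢ i<ℓ) x ⟩
      tr j ℓ (tr ℓ i x) ≡⟨ tr-rotate (<⇒≢ j<ℓ) (>⇒≢ i<j) x ⟩
      tr ℓ i (tr i j x) ≡⟨ tr-sym ℓ i (tr i j x) ⟩
      tr i ℓ (tr i j x) ∎))
    (z-split-join PK ri ri rℓ rj (inside i ℓ)
      (inside-invariant 1≤i i<ℓ ℓ≤n iℓ)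
      (≢-sym (T≢F i ℓ i i<ℓ ≤-refl (inside-left i ℓ ≤-refl)))
      (≢-sym (T≢F i ℓ i i<j (<⇒≤ j<ℓ) (inside-left i ℓ ≤-refl))))
    where open ≡-Reasoning
  ... | no j≢k = trans (sym (rotated j≢k))
    (z-split-split-join-join PK rj rk rℓ ri (inside j k) (inside i ℓ)
      (inside-invariant 1≤j j<k (proj₂ rk) jk)
      (λ {x} rx → trans (cong (inside i ℓ ∘ K) (tr-sym ℓ i x)) (inside-invariant 1≤i i<ℓ ℓ≤n iℓ rx))
      (agree (inside-left j k ≤-refl) (inside-right j k k<ℓ))
      (agree (inside-left j k (<⇒≤ i<j)) (inside-right j k k<ℓ))
      (T≢F j k ℓ j<k ≤-refl (inside-right j k k<ℓ))
      (trans (inside-true i ℓ i<j (<⇒≤ j<ℓ)) (sym (inside-true i ℓ i<ℓ ≤-refl)))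
      (trans (inside-true i ℓ i<k (<⇒≤ k<ℓ)) (sym (inside-true i ℓ i<ℓ ≤-refl)))
      (T≢F i ℓ i i<ℓ ≤-refl (inside-left i ℓ ≤-refl))
      (<⇒≢ j<ℓ))
    where j<k = ≤∧≢⇒< j≤k j≢k

-- Conjugation and the genus

module _ {n f φ} (Pf : Perm n f) (Pφ : Perm n φ) where

  conjugate : ℕ → ℕ
  conjugate = φ ∘ₚ (f ∘ₚ inv n φ)

  conjugate≗ : ∀ {x} → InRange n x → φ (f (inverse Pφ x)) ≡ conjugate x
  conjugate≗ rx = cong (φ ∘ f) (sym (inv-perm Pφ rx))

  conjugate-perm : Perm n conjugate
  conjugate-perm = perm-cong conjugate≗ (∘ₚ-perm Pφ (∘ₚ-perm Pf (inverse-perm Pφ)))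

  z-conjugate : z n conjugate ≡ z n f
  z-conjugate = z-conj conjugate-perm Pf Pφ λ rx →
    trans (sym (conjugate≗ (range Pφ rx))) (cong (φ ∘ f) (inverse-f Pφ rx))

  -- Conjugating (φfφ⁻¹)⁻¹g back by φ gives f⁻¹ · φ⁻¹gφ, and the hypothesis says φ⁻¹gφ = gτ.
  z-conjugate-complement : ∀ {g τ} → Perm n g → Perm n τ →
    (∀ {x} → InRange n x → φ (g (τ x)) ≡ g (φ x)) →
    z n (inv n conjugate ∘ₚ g) ≡ z n ((inverse Pf ∘ₚ g) ∘ₚ τ)
  z-conjugate-complement {g} {τ} Pg Pτ φgτ = z-conj
    (perm-cong (λ rx → sym (inv-perm conjugate-perm (range Pg rx))) (∘ₚ-perm (inverse-perm conjugate-perm) Pg))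
    (∘ₚ-perm (∘ₚ-perm (inverse-perm Pf) Pg) Pτ) Pφ λ {x} rx → begin
      inv n conjugate (g (φ x))             ≡⟨ inv-perm conjugate-perm (range Pg (range Pφ rx)) ⟩
      φ (inverse Pf (inverse Pφ (g (φ x)))) ≡⟨ cong (φ ∘ inverse Pf ∘ inverse Pφ) (φgτ rx) ⟨
      φ (inverse Pf (inverse Pφ (φ (g (τ x))))) ≡⟨ cong (φ ∘ inverse Pf) (inverse-f Pφ (range Pg (range Pτ rx))) ⟩
      φ (inverse Pf (g (τ x))) ∎
    where open ≡-Reasoning

module _ {n : ℕ} {lab : ℕ → ℕ} (nc : NonCrossing n lab) {i b c d : ℕ}
         (1≤i : 1 ≤ i) (1≤b : 1 ≤ b) (1≤d : 1 ≤ d) (ℓ≤n : i + b + c + d ≤ n) where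

  open FourColoring n lab nc i (i + b) (i + b + c) (i + b + c + d)
    1≤i (m<m+n i 1≤b) (m≤m+n (i + b) c) (m<m+n (i + b + c) 1≤d) ℓ≤n
  open ≡-Reasoning


  α : ℕ → ℕ
  α = Φ n lab i (i + b) (i + b + c) (i + b + c + d)

  Pφ : Perm n (φ′ i b c d)
  Pφ = φ′-perm i b c d ℓ≤n

  z-α : z n α ≡ z n (β n lab)
  z-α = z-conjugate {f = β n lab} {φ = φ′ i b c d} (β-perm lab) Pφ

  z-complement : z n (inv n α ∘ₚ ζ n) ≡ z n Kτ
  z-complement = z-conjugate-complement {f = β n lab} {φ = φ′ i b c d} (β-perm lab) Pφ
    {g = ζ n} {τ = tr i (i + b + c) ∘ₚ tr (i + b) (i + b + c + d)} (ζ-perm n) τ-perm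
    (φ′-ζ i b c d 1≤i 1≤b 1≤d ℓ≤n)

  -- Since z(β) + z(K) = n + 1, the genus is half the number of cycles lost from K to Kτ.
  genus : ∀ g → z n Kτ + 2 * g ≡ z n (Kreweras n lab) → HasGenus n α g
  genus g e = begin
    z n α + z n (inv n α ∘ₚ ζ n) + 2 * g
      ≡⟨ cong₂ (λ u v → u + v + 2 * g) z-α z-complement ⟩
    z n (β n lab) + z n Kτ + 2 * g
      ≡⟨ +-assoc (z n (β n lab)) (z n Kτ) (2 * g) ⟩
    z n (β n lab) + (z n Kτ + 2 * g)
      ≡⟨ cong (z n (β n lab) +_) e ⟩
    z n (β n lab) + z n (Kreweras n lab)
      ≡⟨ z-Kreweras nc 1≤n ⟩
    suc n
      ≡⟨ +-comm 1 n ⟩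
    n + 1 ∎
    where
    1≤n = ≤-trans 1≤i (≤-trans (≤-trans (m≤m+n i b) (m≤m+n (i + b) c)) (≤-trans (m≤m+n (i + b + c) d) ℓ≤n))

  genus-1 : Corner → HasGenus n α 1
  genus-1 cor = genus 1 (trans (+-comm (z n Kτ) 2) (z-corner cor))

  genus-by-corner : Dec Corner → (HasGenus n α 0 ⊎ HasGenus n α 1) × (HasGenus n α 1 ⇔ Cond)
  genus-by-corner (yes cor) = inj₂ (genus-1 cor) , mk⇔ (λ _ → corner⇒cond cor) (genus-1 ∘ cond⇒corner)
  genus-by-corner (no ¬cor) = inj₁ genus-0 , mk⇔ (λ g₁ → contradiction g₁ ¬genus-1) (genus-1 ∘ cond⇒corner)
    where
    genus-0 : HasGenus n α 0
    genus-0 = genus 0 (trans (+-identityʳ (z n Kτ)) (separable⇒z (no-corner⇒separable ¬cor)))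
    ¬genus-1 : ¬ HasGenus n α 1
    ¬genus-1 g₁ = contradiction
      (+-cancelˡ-≡ (z n α + z n (inv n α ∘ₚ ζ n)) (2 * 0) (2 * 1) (trans genus-0 (sym g₁))) λ ()

theorem2p3 : (n : ℕ) (lab : ℕ → ℕ) (i j k ℓ : ℕ) →
    NonCrossing n lab →
    1 ≤ i → i < j → j ≤ k → k < ℓ → ℓ ≤ n →
    (HasGenus n (Φ n lab i j k ℓ) 0 ⊎ HasGenus n (Φ n lab i j k ℓ) 1) ×
    (HasGenus n (Φ n lab i j k ℓ) 1 ⇔ (Cond1 n lab i j k ℓ ⊎ Cond2 n lab i j k ℓ))
theorem2p3 n lab i j k ℓ nc 1≤i i<j j≤k k<ℓ ℓ≤n =
  by-lengths (offset i<j (m≤n+m j i)) (m≤n⇒∃[o]m+o≡n j≤k) (offset k<ℓ (m≤n+m ℓ k)) ℓ≤n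
  where
  by-lengths : ∀ {j k ℓ} →
    ∃[ b ] (1 ≤ b × b ≤ j × i + b ≡ j) → ∃[ c ] j + c ≡ k → ∃[ d ] (1 ≤ d × d ≤ ℓ × k + d ≡ ℓ) → ℓ ≤ n →
    (HasGenus n (Φ n lab i j k ℓ) 0 ⊎ HasGenus n (Φ n lab i j k ℓ) 1) ×
    (HasGenus n (Φ n lab i j k ℓ) 1 ⇔ (Cond1 n lab i j k ℓ ⊎ Cond2 n lab i j k ℓ))
  by-lengths (b , 1≤b , _ , refl) (c , refl) (d , 1≤d , _ , refl) ℓ≤n =
    genus-by-corner nc 1≤i 1≤b 1≤d ℓ≤n (FourColoring.corner? n lab nc i (i + b) (i + b + c) (i + b + c + d)
      1≤i (m<m+n i 1≤b) (m≤m+n (i + b) c) (m<m+n (i + b + c) 1≤d) ℓ≤n)
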